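{- Let $p\ge q\ge 1$ be integers. Let $$P_{p,q}=\{(x,y)\in\mathbb{R}^{\mathcal{I}_{p,q}}\times\mathbb{R}^{A_{p,q}} : y\in F_{p,q},\ (x,y)\text{ satisfies (a) and (b)}\},$$ where (a) is $y_{(i-1,j-1)^{\searrow}}\le x_{ij}$ for all $(i,j)\in\mathcal{I}_{p,q}$, and (b) is $x(\mathrm{bar}_{i,j})\le y(\mathrm{in}^{\searrow}(\mathrm{col}_{i,j}))$ for all $(i,j)\in\mathcal{I}_{p,q}$. Let $$P^{=}_{p,q}=\{(x,y)\in P_{p,q} : x(\mathrm{row}_i)=1\text{ for all }i\in[p]\}.$$ Then $P^{=}_{p,q}$ is an extended formulation for the partitioning orbitope $O^{=}_{p,q}$, i.e., the image of $P^{=}_{p,q}$ under the orthogonal projection $(x,y)\mapsto x$ onto $\mathbb{R}^{\mathcal{I}_{p,q}}$ is $O^{=}_{p,q}$.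
   Context: Notation: $[n]=\{1,\dots,n\}$, $[n]_0=\{0,1,\dots,n\}$, $q(i)=\min\{i,q\}$, $\mathcal{I}_{p,q}=\{(i,j)\in[p]\times[q] : i\ge j\}$, $\mathrm{row}_i=\{(i,j)\in\mathcal{I}_{p,q} : j\in[q]\}$. For a vector $z\in\mathbb{R}^M$ and $N\subseteq M$, $z(N)=\sum_{e\in N}z_e$. The partitioning orbitope $O^{=}_{p,q}$ is the convex hull of all 0/1-matrices of size $p\times q$ whose columns are in lexicographically decreasing (i.e., non-increasing, with row 1 the most significant position) order and that have exactly one 1-entry per row. Since no such matrix has a 1 above its main diagonal, the entries $(i,j)$ with $i<j$ are dropped and $O^{=}_{p,q}$ is regarded as a subset of $\mathbb{R}^{\mathcal{I}_{p,q}}$. The directed acyclic graph $D_{p,q}=(V_{p,q},A_{p,q})$ has node set $V_{p,q}=\mathcal{I}_{p,q}\uplus([p]_0\times\{0\})\uplus\{s\}\uplus\{t\}$ and the following arcs: - vertical arcs $(i,j)^{\downarrow}=((i,j),(i+1,j))$ for $i\in[p-1]_0$, $j\in[q(i)]_0$; - diagonal arcs $(i,j)^{\searrow}=((i,j),(i+1,j+1))$ for $i\in[p-1]_0$, $j\in[q(i+1)-1]_0$; - the arc $(s,(0,0))$; - the arcs $((p,j),t)$ for $j\in[q]_0$. $F_{p,q}\subseteq\mathbb{R}^{A_{p,q}}$ is the set of all $s$-$t$-flows in $D_{p,q}$ of flow value one without capacity restrictions: $y\ge 0$, flow conservation at every node other than $s,t$, and one unit of flow leaving $s$. For $W\subseteq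 V_{p,q}$, $\mathrm{in}^{\searrow}(W)$ is the set of diagonal arcs $(u,w)$ with $w\in W$, $u\notin W$. For $(i,j)\in\mathcal{I}_{p,q}$: $\mathrm{bar}_{i,j}=\{(i,\ell)\in\mathcal{I}_{p,q} : \ell\ge j\}$ and $\mathrm{col}_{i,j}=\{(k,j) : j\le k\le i\}$. -}

module Defs where

open import Algebra.Bundles using (CommutativeRing)
open import Data.Bool.Base using (Bool; true; false; if_then_else_) renaming (_<_ to _<ᵇ_)
open import Data.Empty using (⊥)
open import Data.Fin.Base as Fin using (Fin; toℕ; inject≤)
open import Data.Fin.Properties using (toℕ<n; toℕ≤pred[n]) renaming (_≟_ to _≟ᶠ_)
open import Data.List.Base using (List; _∷_; _++_; map; concatMap; filter; foldr; allFin)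
open import Data.Nat.Base using (ℕ; suc; _⊓_; _≤_; z≤n; s≤s)
open import Data.Nat.Properties
  using (_≟_; _≤?_; ≤-refl; ≤-trans; <⇒≤; n≤1+n; m⊓n≤m; m⊓n≤n; ⊓-monoˡ-≤; ⊓-glb)
open import Data.Product using (∃!; ∃-syntax; _×_; _,_)
open import Data.Vec.Base using (Vec; tabulate)
open import Data.Vec.Relation.Binary.Lex.Strict using (Lex-≤)
open import Level using (0ℓ; _⊔_) renaming (suc to lsuc)
open import Relation.Binary.Core using (Rel)
open import Relation.Binary.Definitions using (DecidableEquality)
open import Relation.Binary.PropositionalEquality using (_≡_; _≢_; refl)
open import Relation.Binary.Structures using (IsDecTotalOrder)
open import Relation.Nullary using (¬_; yes; no)
open import Relation.Nullary.Decidable using (_×-dec_; ¬?)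
open import Relation.Unary using (Pred; Decidable)

-- The library has no real numbers; ℝ is replaced by an arbitrary (decidably)
-- totally ordered field.  Classically ℝ is one of these, and so is ℚ.
record OrderedField c ℓ₁ ℓ₂ : Set (lsuc (c ⊔ ℓ₁ ⊔ ℓ₂)) where
  field
    commutativeRing : CommutativeRing c ℓ₁
  open CommutativeRing commutativeRing public
  infix 4 _≲_
  field
    _≲_             : Rel Carrier ℓ₂
    isDecTotalOrder : IsDecTotalOrder _≈_ _≲_
    +-monoʳ-≲       : ∀ x {y z} → y ≲ z → x + y ≲ x + z
    *-nonneg        : ∀ {x y} → 0# ≲ x → 0# ≲ y → 0# ≲ x * y
    1≉0             : ¬ (1# ≈ 0#)
    inverse         : ∀ x → ¬ (x ≈ 0#) → ∃[ x⁻¹ ] x * x⁻¹ ≈ 1#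

-- q ⟨ i ⟩ is the paper's q(i) = min{i,q}.
_⟨_⟩ : ℕ → ℕ → ℕ
q ⟨ i ⟩ = i ⊓ q

-- The index set 𝓘_{p,q} = {(i,j) : i ∈ [p], j ∈ [q(i)]}.  The Fin components
-- are 0-based; the 1-based coordinates are rowOf and colOf.
record Cell (p q : ℕ) : Set where
  constructor cell
  field
    row₀ : Fin p
    col₀ : Fin (q ⟨ suc (toℕ row₀) ⟩)

  rowOf colOf : ℕ
  rowOf = suc (toℕ row₀)
  colOf = suc (toℕ col₀)

open Cell public

-- 𝓘_{p,q} ⊎ ([p]₀ × {0}) = {(i,j) : i ∈ [p]₀, j ∈ [q(i)]₀}.
data Node (p q : ℕ) : Set where
  node : (i j : ℕ) → .(i ≤ p) → .(j ≤ q ⟨ i ⟩) → Node p q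
  s t  : Node p q

data Arc (p q : ℕ) : Set where
  vertical : (i : Fin p) → Fin (suc (q ⟨ toℕ i ⟩)) → Arc p q
  diagonal : (i : Fin p) → Fin (q ⟨ suc (toℕ i) ⟩) → Arc p q
  source   : Arc p q
  -- q ⟨ p ⟩ = q, as q ≤ p.
  sink     : Fin (suc (q ⟨ p ⟩)) → Arc p q

private
  diagonal-tail : ∀ q i (j : Fin (q ⟨ suc i ⟩)) → toℕ j ≤ q ⟨ i ⟩
  diagonal-tail q i j with ≤-trans (toℕ<n j) (m⊓n≤m (suc i) q)
  ... | s≤s j≤i = ⊓-glb j≤i (<⇒≤ (≤-trans (toℕ<n j) (m⊓n≤n (suc i) q)))

tail : ∀ {p q} → Arc p q → Node p q
tail         (vertical i j) = node (toℕ i) (toℕ j) (<⇒≤ (toℕ<n i)) (toℕ≤pred[n] j)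
tail {q = q} (diagonal i j) = node (toℕ i) (toℕ j) (<⇒≤ (toℕ<n i)) (diagonal-tail q (toℕ i) j)
tail         source         = s
tail {p}     (sink j)       = node p (toℕ j) ≤-refl (toℕ≤pred[n] j)

head : ∀ {p q} → Arc p q → Node p q
head {q = q} (vertical i j) =
  node (suc (toℕ i)) (toℕ j) (toℕ<n i) (≤-trans (toℕ≤pred[n] j) (⊓-monoˡ-≤ q (n≤1+n (toℕ i))))
head         (diagonal i j) = node (suc (toℕ i)) (suc (toℕ j)) (toℕ<n i) (toℕ<n j)
head         source         = node 0 0 z≤n z≤n
head         (sink j)       = t

cells : ∀ {p q} → List (Cell p q)
cells = concatMap (λ i → map (cell i) (allFin _)) (allFin _)

arcs : ∀ {p q} → List (Arc p q)
arcs = concatMap (λ i → map (vertical i) (allFin _)) (allFin _)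
    ++ concatMap (λ i → map (diagonal i) (allFin _)) (allFin _)
    ++ source
    ∷  map sink (allFin _)

_≟ᴺ_ : ∀ {p q} → DecidableEquality (Node p q)
node i j _ _ ≟ᴺ node k l _ _ with i ≟ k | j ≟ l
... | yes refl | yes refl = yes refl
... | no i≢k   | _        = no λ { refl → i≢k refl }
... | yes _    | no j≢l   = no λ { refl → j≢l refl }
node _ _ _ _ ≟ᴺ s = no λ ()
node _ _ _ _ ≟ᴺ t = no λ ()
s ≟ᴺ node _ _ _ _ = no λ ()
s ≟ᴺ s = yes refl
s ≟ᴺ t = no λ ()
t ≟ᴺ node _ _ _ _ = no λ ()
t ≟ᴺ s = no λ ()
t ≟ᴺ t = yes refl

data IsDiagonal {p q} : Pred (Arc p q) 0ℓ where
  isDiagonal : ∀ {i j} → IsDiagonal (diagonal i j)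

isDiagonal? : ∀ {p q} → Decidable (IsDiagonal {p} {q})
isDiagonal? (vertical _ _) = no λ ()
isDiagonal? (diagonal _ _) = yes isDiagonal
isDiagonal? source         = no λ ()
isDiagonal? (sink _)       = no λ ()

module _ {p q : ℕ} where

  Row : Fin p → Pred (Cell p q) _
  Row i e = row₀ e ≡ i

  row? : ∀ i → Decidable (Row i)
  row? i e = row₀ e ≟ᶠ i

  Bar : Cell p q → Pred (Cell p q) _
  Bar e f = rowOf f ≡ rowOf e × colOf e ≤ colOf f

  bar? : ∀ e → Decidable (Bar e)
  bar? e f = (rowOf f ≟ rowOf e) ×-dec (colOf e ≤? colOf f)

  Col : Cell p q → Pred (Node p q) _
  Col e (node k l _ _) = l ≡ colOf e × colOf e ≤ k × k ≤ rowOf e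
  Col e s              = ⊥
  Col e t              = ⊥

  col? : ∀ e → Decidable (Col e)
  col? e (node k l _ _) = (l ≟ colOf e) ×-dec (colOf e ≤? k) ×-dec (k ≤? rowOf e)
  col? e s              = no λ ()
  col? e t              = no λ ()

  In In↘ : ∀ {ℓ} → Pred (Node p q) ℓ → Pred (Arc p q) ℓ
  In  W a = W (head a) × ¬ W (tail a)
  In↘ W a = IsDiagonal a × In W a

  in↘? : ∀ {ℓ} {W : Pred (Node p q) ℓ} → Decidable W → Decidable (In↘ W)
  in↘? W? a = isDiagonal? a ×-dec W? (head a) ×-dec ¬? (W? (tail a))

Matrix : ℕ → ℕ → Set
Matrix p q = Fin p → Fin q → Bool

column : ∀ {p q} → Matrix p q → Fin q → Vec Bool p
column M j = tabulate λ i → M i j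

_≤ˡᵉˣ_ : ∀ {n} → Rel (Vec Bool n) _
_≤ˡᵉˣ_ = Lex-≤ _≡_ _<ᵇ_

record IsOrbitopeMatrix {p q} (M : Matrix p q) : Set where
  field
    columnsDecreasing : ∀ {j k} → j Fin.< k → column M k ≤ˡᵉˣ column M j
    oneOnePerRow      : ∀ i → ∃! _≡_ λ j → M i j ≡ true

module _ {c ℓ₁ ℓ₂} (K : OrderedField c ℓ₁ ℓ₂) where

  open OrderedField K
  open import Algebra.Properties.Monoid.Sum +-monoid using (sum)

  -- For an enumeration es of the index set, z(N) = ∑_{e ∈ N} z_e.
  sumOver : ∀ {e ℓ} {E : Set e} → List E → (E → Carrier) → {N : Pred E ℓ} → Decidable N → Carrier
  sumOver es z N? = foldr _+_ 0# (map z (filter N? es))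

  record ConvexHull {e ℓ} {E : Set e} (S : Pred (E → Carrier) ℓ) (x : E → Carrier)
                    : Set (c ⊔ ℓ₁ ⊔ ℓ₂ ⊔ e ⊔ ℓ) where
    field
      size    : ℕ
      point   : Fin size → E → Carrier
      weight  : Fin size → Carrier
      point∈S : ∀ k → S (point k)
      nonneg  : ∀ k → 0# ≲ weight k
      total   : sum weight ≈ 1#
      combine : ∀ i → x i ≈ sum (λ k → weight k * point k i)

  module _ (p q : ℕ) where

    OrbitopeVertex : Pred (Fin p × Fin q → Carrier) ℓ₁
    OrbitopeVertex X = ∃[ M ] IsOrbitopeMatrix M × (∀ i j → X (i , j) ≈ (if M i j then 1# else 0#))

    -- Elements of the hull with the entries above the diagonal dropped.
    O⁼ : Pred (Cell p q → Carrier) _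
    O⁼ x = ∃[ X ] ConvexHull OrbitopeVertex X ×
                  (∀ e → x e ≈ X (row₀ e , inject≤ (col₀ e) (m⊓n≤n (rowOf e) q)))

    _[_] : (Cell p q → Carrier) → ∀ {ℓ} {N : Pred (Cell p q) ℓ} → Decidable N → Carrier
    x [ N? ] = sumOver cells x N?

    _[_]ᴬ : (Arc p q → Carrier) → ∀ {ℓ} {N : Pred (Arc p q) ℓ} → Decidable N → Carrier
    y [ N? ]ᴬ = sumOver arcs y N?

    inflow outflow : (Arc p q → Carrier) → Node p q → Carrier
    inflow  y v = y [ (λ a → head a ≟ᴺ v) ]ᴬ
    outflow y v = y [ (λ a → tail a ≟ᴺ v) ]ᴬ

    record F (y : Arc p q → Carrier) : Set (ℓ₁ ⊔ ℓ₂) where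
      field
        nonneg       : ∀ a → 0# ≲ y a
        conservation : ∀ v → v ≢ s → v ≢ t → inflow y v ≈ outflow y v
        unitValue    : outflow y s ≈ 1#

    record P (x : Cell p q → Carrier) (y : Arc p q → Carrier) : Set (ℓ₁ ⊔ ℓ₂) where
      field
        flow  : F y
        -- The arc (i-1,j-1)↘ into the cell (i,j) is diagonal row₀ col₀,
        -- as i-1 and j-1 are the 0-based positions of the cell.
        condA : ∀ e → y (diagonal (row₀ e) (col₀ e)) ≲ x e
        condB : ∀ e → x [ bar? e ] ≲ y [ in↘? (col? e) ]ᴬ

    record P⁼ (x : Cell p q → Carrier) (y : Arc p q → Carrier) : Set (ℓ₁ ⊔ ℓ₂) where
      field
        inP     : P x y
        rowSums : ∀ i → x [ row? i ] ≈ 1#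

    projP⁼ : Pred (Cell p q → Carrier) _
    projP⁼ x = ∃[ y ] P⁼ x y

{-# OPTIONS --safe #-}
-- The vertices of the orbitope are the restricted growth words of length p: letter i is the column of
-- the 1 in row i, and it is at most one more than the largest letter before it.  The number of
-- columns opened so far traces an s-t-path, with a diagonal arc for each new column, so a convex
-- combination of words yields the flow of its weighted paths, and (a), (b) hold word by word.
--
-- Conversely, read the flow as the distribution of the number of open columns, and build a finite
-- measure on words from the last row upwards, keeping the marginals x and the node flows as
-- distribution of the state.  In each row, serve the columns j from right to left: mass
-- y_{(i-1,j-1)↘} from the state j opens column j, and mass x_ij - y_{(i-1,j-1)↘}, nonnegative by (a),
-- reuses it, drawn greedily from all states ≥ j.  Condition (b) says exactly that enough mass is
-- left, and the row sum 1 that nothing remains at the end.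
module Submission where

open import Defs
open import Data.Bool.Base using (true; false; if_then_else_; f<t) renaming (_<_ to _<ᵇ_)
open import Data.Empty using (⊥-elim)
open import Data.Fin.Base using (Fin; zero; suc; toℕ; fromℕ<; inject≤)
open import Data.Fin.Properties
  using (toℕ<n; toℕ-injective; toℕ-fromℕ<; toℕ-inject≤) renaming (_≟_ to _≟ᶠ_)
open import Data.List.Base
  using (List; []; _∷_; _++_; map; concatMap; foldr; length; lookup; tabulate; allFin)
open import Data.Nat.Base as ℕ using (ℕ; zero; suc; _≤_; _<_; s≤s; z≤n)
open import Data.Nat.Properties
  using ( +-suc; 1+n≢n; 1+n≰n; <-cmp; <-trans; <-≤-trans; <⇒≢; <⇒≤; <⇒≱
        ; _<?_; _≟_; _≤?_; m≤m+n; m≤n+m; m≤n⇒m<n∨m≡n; m≤n⇒m≤1+n; m⊓n≤m; m⊓n≤n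
        ; n<1+n; n≤1+n; suc-injective; ≤-<-trans; ≤-pred; ≤-refl; ≤-reflexive; ≤-total; ≤-trans
        ; ≮⇒≥; ≰⇒>; ⊓-glb; ⊓-monoʳ-≤; ⊓-monoˡ-≤ )
  renaming (+-identityʳ to ℕ-+-identityʳ)
open import Data.Product using (∃; ∃-syntax; Σ-syntax; _×_; _,_; proj₁; proj₂)
open import Data.Sum.Base using (_⊎_; inj₁; inj₂; [_,_]′)
open import Data.Unit.Base using (tt)
open import Data.Vec.Base as Vec using (Vec; []; _∷_)
open import Data.Vec.Properties using (lookup∘tabulate)
open import Data.Vec.Relation.Binary.Lex.Core using (base; this; next)
open import Function.Base using (_∘_; id)
open import Function.Bundles using (_⇔_; mk⇔)
open import Level using (Level; _⊔_)
open import Relation.Binary.Bundles using (Poset)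
open import Relation.Binary.Definitions using (tri<; tri≈; tri>)
open import Relation.Binary.PropositionalEquality as ≡ using (_≡_)
open import Relation.Binary.Structures using (IsDecTotalOrder)
open import Relation.Nullary using (Dec; yes; no; ¬_; does; recompute)
open import Relation.Nullary.Decidable using (_×-dec_; dec-true; dec-false)
open import Relation.Unary using (Pred; Decidable)

-- Rows interact only through the distribution of the state. Prepending a letter that opens a column
-- lowers the state by one, and reusing a column leaves it alone; so whichever words the reused mass
-- is drawn from, the states handed to the row above are distributed as the flow prescribes. Hence
-- an arbitrary greedy choice is safe, however letters and states end up correlated.
--
-- Condition (b) is a supply bound because a path that reaches column `j` enters it by exactly one
-- diagonal arc: the diagonal arcs into it up to row `i` carry the flow through all nodes of row `i`
-- in columns `≥ j`. The states that may serve column `j` form exactly this upper tail. Tails are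
-- nested, so demands bounded by tails can be met one column after another, without a matching
-- argument. State distributions are therefore kept as tails throughout.
--
-- Rows and letters are 0-based in the code, while the state counts columns: letter `l` is column
-- `l + 1`, and it requires a state `> l` after its row.

private
  variable
    a b : Level
    A B E : Set a
    Q : Set a
    R : Set b
    m n q : ℕ
    ls : Vec (Fin q) n

-- Growing m v: v continues a word in which the columns 0, …, m - 1 are open.  In the digraph, old is a
-- vertical arc out of the node (i, m) and new the diagonal arc.
data Growing {q : ℕ} : ∀ {n} → ℕ → Vec (Fin q) n → Set where
  []  : ∀ {m} → Growing m []
  old : ∀ {m n a} {v : Vec (Fin q) n} → toℕ a < m → Growing m v → Growing m (a ∷ v)
  new : ∀ {m n a} {v : Vec (Fin q) n} → toℕ a ≡ m → Growing (suc m) v → Growing m (a ∷ v)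

-- The letters do not determine the state: the empty word grows from any number of open columns. As
-- words are built backwards, the number of columns that the rows above still have to open is
-- carried along.
record Word (q n : ℕ) : Set where
  constructor word
  field
    state   : ℕ
    letters : Vec (Fin q) n
    growing : Growing state letters

open Word

-- Growing words and orbitope matrices

matrix : ∀ {p q} → Vec (Fin q) p → Matrix p q
matrix v i j = does (Vec.lookup v i ≟ᶠ j)

-- Column `k` cannot open before `j`. While both are closed their entries are 0, and the row that
-- opens `j` decides the comparison. Columns below `m` were decided in the row that opened them.
growing⇒decreasing : ∀ {n q m} {v : Vec (Fin q) n} → Growing m v →
                     ∀ {j k} → m ≤ toℕ j → toℕ j < toℕ k →
                     column (matrix v) k ≤ˡᵉˣ column (matrix v) j
growing⇒decreasing []                    _   _   = base tt
growing⇒decreasing (old {a = a} a<m g) {j} {k} m≤j j<k =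
  next (≡.trans (dec-false (a ≟ᶠ k) (λ { ≡.refl → <⇒≢ (<-trans (<-≤-trans a<m m≤j) j<k) ≡.refl }))
       (≡.sym (dec-false (a ≟ᶠ j) λ { ≡.refl → <⇒≢ (<-≤-trans a<m m≤j) ≡.refl })))
       (growing⇒decreasing g m≤j j<k)
growing⇒decreasing (new {a = a} ≡.refl g) {j} {k} m≤j j<k
  with a ≟ᶠ j | dec-false (a ≟ᶠ k) (λ { ≡.refl → <⇒≢ (≤-<-trans m≤j j<k) ≡.refl })
... | yes _   | a≢k rewrite a≢k = this f<t ≡.refl
... | no  a≢j | a≢k rewrite a≢k = next ≡.refl (growing⇒decreasing g a<j j<k)
  where
  a<j : toℕ a < toℕ j
  a<j with m≤n⇒m<n∨m≡n m≤j
  ... | inj₁ a<j = a<j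
  ... | inj₂ a≡j = ⊥-elim (a≢j (toℕ-injective a≡j))

growing⇒orbitope : ∀ {p q} {v : Vec (Fin q) p} → Growing 0 v → IsOrbitopeMatrix (matrix v)
growing⇒orbitope {v = v} g = record
  { columnsDecreasing = growing⇒decreasing g z≤n
  ; oneOnePerRow      = λ i → Vec.lookup v i , dec-true (Vec.lookup v i ≟ᶠ _) ≡.refl , λ {j} → unique i j
  }
  where
  unique : ∀ i j → matrix v i j ≡ true → Vec.lookup v i ≡ j
  unique i j eq with Vec.lookup v i ≟ᶠ j | eq
  ... | yes eq | _ = eq
  ... | no _   | ()

private
  <ᵇ⇒false,true : ∀ {b c} → b <ᵇ c → b ≡ false × c ≡ true
  <ᵇ⇒false,true f<t = ≡.refl , ≡.refl

-- The order is assumed only from column `m` on, because the row that opens a column settles its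
-- comparison with all later ones and leaves the remaining rows free.
decreasing⇒growing : ∀ {n q} m (M : Matrix n q) (a : Fin n → Fin q) →
                     (∀ i → M i (a i) ≡ true) → (∀ i {j} → M i j ≡ true → a i ≡ j) →
                     (∀ {j k} → m ≤ toℕ j → toℕ j < toℕ k → column M k ≤ˡᵉˣ column M j) →
                     Growing m (Vec.tabulate a)
decreasing⇒growing {zero}      m M a M-a M⇒a decreasing = []
decreasing⇒growing {suc n} {q} m M a M-a M⇒a decreasing with <-cmp (toℕ (a zero)) m
... | tri< a<m _ _ = old a<m
  (decreasing⇒growing m (M ∘ suc) (a ∘ suc) (M-a ∘ suc) (λ i → M⇒a (suc i)) decreasing′)
  where
  decreasing′ : ∀ {j k} → m ≤ toℕ j → toℕ j < toℕ k → column (M ∘ suc) k ≤ˡᵉˣ column (M ∘ suc) j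
  decreasing′ m≤j j<k with decreasing m≤j j<k
  ... | next _ le = le
  ... | this lt _ = ⊥-elim (<⇒≢ (<-≤-trans a<m m≤j) (≡.cong toℕ (M⇒a zero (proj₂ (<ᵇ⇒false,true lt)))))
... | tri≈ _ ≡.refl _ = new ≡.refl
  (decreasing⇒growing (suc m) (M ∘ suc) (a ∘ suc) (M-a ∘ suc) (λ i → M⇒a (suc i)) decreasing′)
  where
  decreasing′ : ∀ {j k} → suc m ≤ toℕ j → toℕ j < toℕ k → column (M ∘ suc) k ≤ˡᵉˣ column (M ∘ suc) j
  decreasing′ m<j j<k with decreasing (<⇒≤ m<j) j<k
  ... | next _ le = le
  ... | this lt _ = ⊥-elim (<⇒≢ m<j (≡.cong toℕ (M⇒a zero (proj₂ (<ᵇ⇒false,true lt)))))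
... | tri> _ _ m<a = ⊥-elim (absurd (decreasing (≤-reflexive (≡.sym j≡m)) j<a))
  where
  -- The skipped column `m`: it exists since `m < a zero < q`, and it has a 0 in the row where the
  -- later column `a zero` has a 1.
  j : Fin q
  j = fromℕ< (<-trans m<a (toℕ<n (a zero)))
  j≡m : toℕ j ≡ m
  j≡m = toℕ-fromℕ< (<-trans m<a (toℕ<n (a zero)))
  j<a : toℕ j < toℕ (a zero)
  j<a = ≡.subst (_< toℕ (a zero)) (≡.sym j≡m) m<a
  absurd : ¬ (column M (a zero) ≤ˡᵉˣ column M j)
  absurd (this lt _) with ≡.trans (≡.sym (M-a zero)) (proj₁ (<ᵇ⇒false,true lt))
  ... | ()
  absurd (next eq _) = <⇒≢ j<a (≡.cong toℕ (≡.sym (M⇒a zero (≡.trans (≡.sym eq) (M-a zero)))))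

orbitope⇒growing : ∀ {p q} {M : Matrix p q} → IsOrbitopeMatrix M →
                   Σ[ v ∈ Vec (Fin q) p ] Growing 0 v × (∀ i j → M i j ≡ matrix v i j)
orbitope⇒growing {p} {q} {M} orbitope =
  Vec.tabulate letter ,
  decreasing⇒growing 0 M letter hit (λ i → unique i) (λ _ → columnsDecreasing) ,
  λ i j → ≡.trans (M≡letter i j) (≡.cong (λ k → does (k ≟ᶠ j)) (≡.sym (lookup∘tabulate letter i)))
  where
  open IsOrbitopeMatrix orbitope
  letter : Fin p → Fin q
  letter i = proj₁ (oneOnePerRow i)
  hit : ∀ i → M i (letter i) ≡ true
  hit i = proj₁ (proj₂ (oneOnePerRow i))
  unique : ∀ i {j} → M i j ≡ true → letter i ≡ j
  unique i = proj₂ (proj₂ (oneOnePerRow i))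
  M≡letter : ∀ i j → M i j ≡ does (letter i ≟ᶠ j)
  M≡letter i j with letter i ≟ᶠ j
  ... | yes ≡.refl = hit i
  ... | no letter≢j with M i j in eq
  ...   | true  = ⊥-elim (letter≢j (unique i eq))
  ...   | false = ≡.refl

-- The path of a word

-- Beyond the last letter the state is frozen, so only indices up to the length of the word describe
-- the path.
stateAt : Growing m ls → ℕ → ℕ
stateAt {m = m} _         zero    = m
stateAt {m = m} []        (suc k) = m
stateAt         (old _ g) (suc k) = stateAt g k
stateAt         (new _ g) (suc k) = stateAt g k

data Step (a m m′ : ℕ) : Set where
  stays    : m′ ≡ m → a < m → Step a m m′
  advances : m′ ≡ suc m → a ≡ m → Step a m m′

step : (g : Growing m ls) (i : Fin n) →
       Step (toℕ (Vec.lookup ls i)) (stateAt g (toℕ i)) (stateAt g (suc (toℕ i)))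
step (old a<m g) zero    = stays ≡.refl a<m
step (new a≡m g) zero    = advances ≡.refl a≡m
step (old _ g)   (suc i) = step g i
step (new _ g)   (suc i) = step g i

letter<state : ∀ {a m m′} → Step a m m′ → a < m′
letter<state (stays ≡.refl a<m)       = a<m
letter<state (advances ≡.refl ≡.refl) = ≤-refl

state≤state : ∀ {a m m′} → Step a m m′ → m ≤ m′
state≤state (stays ≡.refl _)    = ≤-refl
state≤state (advances ≡.refl _) = n≤1+n _

stateAt≤index : (g : Growing m ls) → ∀ k → stateAt g k ≤ k ℕ.+ m
stateAt≤index         g         zero    = ≤-refl
stateAt≤index {m = m} []        (suc k) = m≤n+m m (suc k)
stateAt≤index         (old _ g) (suc k) = m≤n⇒m≤1+n (stateAt≤index g k)
stateAt≤index {m = m} (new _ g) (suc k) = ≡.subst (stateAt g k ≤_) (+-suc k m) (stateAt≤index g k)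

stateAt≤q : {ls : Vec (Fin q) n} (g : Growing m ls) → m ≤ q → ∀ k → stateAt g k ≤ q
stateAt≤q             g               m≤q zero    = m≤q
stateAt≤q             []              m≤q (suc k) = m≤q
stateAt≤q             (old _ g)       m≤q (suc k) = stateAt≤q g m≤q k
stateAt≤q             (new {a = a} ≡.refl g) m≤q (suc k) = stateAt≤q g (toℕ<n a) k

-- This keeps the path inside the digraph: a letter opens at most one column, and every opened
-- column is one of the `q`.
stateAt≤⊓ : {ls : Vec (Fin q) n} (g : Growing 0 ls) → ∀ k → stateAt g k ≤ q ⟨ k ⟩
stateAt≤⊓ g k = ⊓-glb (≡.subst (stateAt g k ≤_) (ℕ-+-identityʳ k) (stateAt≤index g k)) (stateAt≤q g z≤n k)

module OverField {c ℓ₁ ℓ₂} (K : OrderedField c ℓ₁ ℓ₂) where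
  open OrderedField K hiding (zero)
  open IsDecTotalOrder isDecTotalOrder
    using (antisym; isPartialOrder)
    renaming (total to ≲-total; refl to ≲-refl; trans to ≲-trans; reflexive to ≲-reflexive)
  open import Algebra.Properties.Group +-group
    using () renaming (∙-cancelˡ to +-cancelˡ; ∙-cancelʳ to +-cancelʳ)
  open import Algebra.Solver.Ring.NaturalCoefficients.Default commutativeSemiring
    using (solve; _:=_; _:+_; _:*_; con)
  open import Algebra.Properties.CommutativeSemigroup +-commutativeSemigroup
    using (x∙yz≈y∙xz)

  poset : Poset c ℓ₁ ℓ₂
  poset = record { isPartialOrder = isPartialOrder }

  open import Relation.Binary.Reasoning.PartialOrder poset

  -- Ordered fields

  +-mono-≲ : ∀ {w x y z} → w ≲ x → y ≲ z → w + y ≲ x + z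
  +-mono-≲ {w} {x} {y} {z} w≲x y≲z = begin
    w + y ≤⟨ +-monoʳ-≲ w y≲z ⟩
    w + z ≈⟨ +-comm w z ⟩
    z + w ≤⟨ +-monoʳ-≲ z w≲x ⟩
    z + x ≈⟨ +-comm z x ⟩
    x + z ∎

  +-nonneg : ∀ {x y} → 0# ≲ x → 0# ≲ y → 0# ≲ x + y
  +-nonneg {x} {y} 0≲x 0≲y = begin
    0#      ≈⟨ +-identityˡ 0# ⟨
    0# + 0# ≤⟨ +-mono-≲ 0≲x 0≲y ⟩
    x + y   ∎

  +-cancelˡ-≲ : ∀ x {y z} → x + y ≲ x + z → y ≲ z
  +-cancelˡ-≲ x {y} {z} le = begin
    y             ≈⟨ lemma y ⟩
    - x + (x + y) ≤⟨ +-monoʳ-≲ (- x) le ⟩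
    - x + (x + z) ≈⟨ lemma z ⟨
    z             ∎
    where
    lemma : ∀ u → u ≈ - x + (x + u)
    lemma u = begin-equality
      u             ≈⟨ +-identityˡ u ⟨
      0# + u        ≈⟨ +-congʳ (-‿inverseˡ x) ⟨
      (- x + x) + u ≈⟨ +-assoc (- x) x u ⟩
      - x + (x + u) ∎

  x≲x+y : ∀ {x y} → 0# ≲ y → x ≲ x + y
  x≲x+y {x} {y} 0≲y = begin
    x      ≈⟨ +-identityʳ x ⟨
    x + 0# ≤⟨ +-monoʳ-≲ x 0≲y ⟩
    x + y  ∎

  x≲y+x : ∀ {x y} → 0# ≲ y → x ≲ y + x
  x≲y+x {x} {y} 0≲y = begin
    x     ≤⟨ x≲x+y 0≲y ⟩
    x + y ≈⟨ +-comm x y ⟩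
    y + x ∎

  difference : ∀ {x y} → x ≲ y → ∃[ z ] 0# ≲ z × y ≈ x + z
  difference {x} {y} x≲y = - x + y , +-cancelˡ-≲ x le , sym y≈
    where
    y≈ : x + (- x + y) ≈ y
    y≈ = begin-equality
      x + (- x + y) ≈⟨ +-assoc x (- x) y ⟨
      (x + - x) + y ≈⟨ +-congʳ (-‿inverseʳ x) ⟩
      0# + y        ≈⟨ +-identityˡ y ⟩
      y             ∎
    le : x + 0# ≲ x + (- x + y)
    le = begin
      x + 0#        ≈⟨ +-identityʳ x ⟩
      x             ≤⟨ x≲y ⟩
      y             ≈⟨ y≈ ⟨
      x + (- x + y) ∎

  +-zeroˡ : ∀ {x y} → 0# ≲ x → 0# ≲ y → x + y ≈ 0# → x ≈ 0#
  +-zeroˡ 0≲x 0≲y x+y≈0 = antisym (≲-trans (x≲x+y 0≲y) (≲-reflexive x+y≈0)) 0≲x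

  -- If `1# ≲ 0#`, then `z = - 1#` is nonnegative, and so is its square `z * z ≈ 1#`.
  0≲1 : 0# ≲ 1#
  0≲1 with ≲-total 0# 1#
  ... | inj₁ 0≲1 = 0≲1
  ... | inj₂ 1≲0 with difference 1≲0
  ...   | z , 0≲z , 0≈1+z = begin
    0#     ≤⟨ *-nonneg 0≲z 0≲z ⟩
    z * z  ≈⟨ +-cancelˡ z _ _ (begin-equality
      z + z * z    ≈⟨ solve 1 (λ z → z :+ z :* z := (con 1 :+ z) :* z) refl z ⟩
      (1# + z) * z ≈⟨ *-congʳ 0≈1+z ⟨
      0# * z       ≈⟨ zeroˡ z ⟩
      0#           ≈⟨ 0≈1+z ⟩
      1# + z       ≈⟨ +-comm 1# z ⟩
      z + 1#       ∎) ⟩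
    1#     ∎

  -- Indicators

  infixr 8 [_]·_
  -- Branching on `does` lets indicators compute: inside a sum, `suc i ≟ suc k` reduces to `i ≟ k`.
  [_]·_ : Dec Q → Carrier → Carrier
  [ d ]· x = if does d then x else 0#

  𝟙 : Dec Q → Carrier
  𝟙 d = [ d ]· 1#

  []·-yes : (Q? : Dec Q) → Q → ∀ {x} → [ Q? ]· x ≈ x
  []·-yes (yes _) q = refl
  []·-yes (no ¬q) q = ⊥-elim (¬q q)

  []·-no : (Q? : Dec Q) → ¬ Q → ∀ {x} → [ Q? ]· x ≈ 0#
  []·-no (yes q) ¬q = ⊥-elim (¬q q)
  []·-no (no _)  ¬q = refl

  []·-cong : (Q? : Dec Q) → ∀ {x y} → x ≈ y → [ Q? ]· x ≈ [ Q? ]· y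
  []·-cong (yes _) x≈y = x≈y
  []·-cong (no _)  x≈y = refl

  []·-zero : (Q? : Dec Q) → ∀ {x} → (Q → x ≈ 0#) → [ Q? ]· x ≈ 0#
  []·-zero (yes q) x≈0 = x≈0 q
  []·-zero (no _)  x≈0 = refl

  []·-nonneg : (Q? : Dec Q) → ∀ {x} → 0# ≲ x → 0# ≲ [ Q? ]· x
  []·-nonneg (yes _) 0≲x = 0≲x
  []·-nonneg (no _)  0≲x = ≲-refl

  𝟙-nonneg : (Q? : Dec Q) → 0# ≲ 𝟙 Q?
  𝟙-nonneg Q? = []·-nonneg Q? 0≲1

  []·-⇔ : (Q? : Dec Q) (R? : Dec R) → (Q → R) → (R → Q) → ∀ {x} → [ Q? ]· x ≈ [ R? ]· x
  []·-⇔ (yes q) R? to from = sym ([]·-yes R? (to q))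
  []·-⇔ (no ¬q) R? to from = sym ([]·-no R? (¬q ∘ from))

  𝟙-mono : (Q? : Dec Q) (R? : Dec R) → (Q → R) → 𝟙 Q? ≲ 𝟙 R?
  𝟙-mono (yes q) R? to = ≲-reflexive (sym ([]·-yes R? (to q)))
  𝟙-mono (no ¬q) R? to = 𝟙-nonneg R?

  𝟙-⊎ : ∀ {s} {S : Set s} (Q? : Dec Q) (R? : Dec R) (S? : Dec S) →
        (Q → S) → (R → S) → (S → Q ⊎ R) → ¬ (Q × R) → 𝟙 Q? + 𝟙 R? ≈ 𝟙 S?
  𝟙-⊎ (yes q) (yes r) S? q⇒s r⇒s s⇒q⊎r ¬both = ⊥-elim (¬both (q , r))
  𝟙-⊎ (yes q) (no _)  S? q⇒s r⇒s s⇒q⊎r ¬both = trans (+-identityʳ 1#) (sym ([]·-yes S? (q⇒s q)))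
  𝟙-⊎ (no _)  (yes r) S? q⇒s r⇒s s⇒q⊎r ¬both = trans (+-identityˡ 1#) (sym ([]·-yes S? (r⇒s r)))
  𝟙-⊎ (no ¬q) (no ¬r) S? q⇒s r⇒s s⇒q⊎r ¬both =
    trans (+-identityˡ 0#) (sym ([]·-no S? λ s → [ ¬q , ¬r ]′ (s⇒q⊎r s)))

  -- Finite measures

  -- Measures are compared only through `∫`, so atoms may repeat or have weight 0. The list of atoms
  -- finally becomes the list of summands of a convex combination.
  Measure : Set a → Set _
  Measure A = List (A × ∃[ w ] 0# ≲ w)

  ∫ : Measure A → (A → Carrier) → Carrier
  ∫ []              φ = 0#
  ∫ ((x , w , _) ∷ μ) φ = w * φ x + ∫ μ φ

  mass : Measure A → Carrier
  mass μ = ∫ μ (λ _ → 1#)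

  push : (A → B) → Measure A → Measure B
  push f = map λ { (x , w) → f x , w }

  ∫-cong : ∀ (μ : Measure A) {φ ψ} → (∀ x → φ x ≈ ψ x) → ∫ μ φ ≈ ∫ μ ψ
  ∫-cong []              eq = refl
  ∫-cong ((x , w , _) ∷ μ) eq = +-cong (*-congˡ (eq x)) (∫-cong μ eq)

  *-monoˡ-≲ : ∀ {w x y} → 0# ≲ w → x ≲ y → w * x ≲ w * y
  *-monoˡ-≲ {w} {x} {y} 0≲w x≲y with difference x≲y
  ... | z , 0≲z , y≈x+z = begin
    w * x         ≤⟨ x≲x+y (*-nonneg 0≲w 0≲z) ⟩
    w * x + w * z ≈⟨ distribˡ w x z ⟨
    w * (x + z)   ≈⟨ *-congˡ y≈x+z ⟨
    w * y         ∎

  ∫-mono : ∀ (μ : Measure A) {φ ψ} → (∀ x → φ x ≲ ψ x) → ∫ μ φ ≲ ∫ μ ψ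
  ∫-mono []                le = ≲-refl
  ∫-mono ((x , w , 0≲w) ∷ μ) le = +-mono-≲ (*-monoˡ-≲ 0≲w (le x)) (∫-mono μ le)

  ∫-zero : ∀ (μ : Measure A) {φ} → (∀ x → φ x ≈ 0#) → ∫ μ φ ≈ 0#
  ∫-zero []              eq = refl
  ∫-zero ((x , w , _) ∷ μ) {φ} eq = begin-equality
    w * φ x + ∫ μ φ ≈⟨ +-cong (*-congˡ (eq x)) (∫-zero μ eq) ⟩
    w * 0# + 0#     ≈⟨ solve 1 (λ w → w :* con 0 :+ con 0 := con 0) refl w ⟩
    0#              ∎

  ∫-nonneg : ∀ (μ : Measure A) {φ} → (∀ x → 0# ≲ φ x) → 0# ≲ ∫ μ φ
  ∫-nonneg μ 0≲φ = ≲-trans (≲-reflexive (sym (∫-zero μ λ _ → refl))) (∫-mono μ 0≲φ)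

  ∫-+ : ∀ (μ : Measure A) φ ψ → ∫ μ (λ x → φ x + ψ x) ≈ ∫ μ φ + ∫ μ ψ
  ∫-+ []              φ ψ = sym (+-identityˡ 0#)
  ∫-+ ((x , w , _) ∷ μ) φ ψ = trans (+-congˡ (∫-+ μ φ ψ))
    (solve 5 (λ w a b c d → w :* (a :+ b) :+ (c :+ d) := (w :* a :+ c) :+ (w :* b :+ d)) refl
      w (φ x) (ψ x) (∫ μ φ) (∫ μ ψ))

  ∫-const : ∀ (μ : Measure A) k → ∫ μ (λ _ → k) ≈ mass μ * k
  ∫-const []              k = sym (zeroˡ k)
  ∫-const ((x , w , _) ∷ μ) k = trans (+-congˡ (∫-const μ k))
    (solve 3 (λ w k m → w :* k :+ m :* k := (w :* con 1 :+ m) :* k) refl w k (mass μ))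

  ∫-++ : ∀ (μ ν : Measure A) φ → ∫ (μ ++ ν) φ ≈ ∫ μ φ + ∫ ν φ
  ∫-++ []      ν φ = sym (+-identityˡ _)
  ∫-++ (_ ∷ μ) ν φ = trans (+-congˡ (∫-++ μ ν φ)) (sym (+-assoc _ _ _))

  ∫-push : ∀ (f : A → B) μ φ → ∫ (push f μ) φ ≈ ∫ μ (φ ∘ f)
  ∫-push f []      φ = refl
  ∫-push f (_ ∷ μ) φ = +-congˡ (∫-push f μ φ)

  ∫-[]· : (Q? : Dec Q) (μ : Measure A) (φ : A → Carrier) →
          [ Q? ]· ∫ μ φ ≈ ∫ μ (λ x → [ Q? ]· φ x)
  ∫-[]· Q? μ φ with does Q?
  ... | true  = refl
  ... | false = sym (∫-zero μ λ _ → refl)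

  -- Nonnegative weights that add up to 0 vanish one by one, so no sign of `φ` is required. This
  -- discards the leftovers of an extraction.
  ∫-null : ∀ (μ : Measure A) φ → mass μ ≈ 0# → ∫ μ φ ≈ 0#
  ∫-null []                _ _    = refl
  ∫-null ((x , w , 0≲w) ∷ μ) φ null = begin-equality
    w * φ x + ∫ μ φ ≈⟨ +-cong (*-congʳ w≈0) (∫-null μ φ (+-zeroˡ 0≲m 0≲w1 (trans (+-comm _ _) null))) ⟩
    0# * φ x + 0#   ≈⟨ solve 1 (λ x → con 0 :* x :+ con 0 := con 0) refl (φ x) ⟩
    0#              ∎
    where
    0≲m : 0# ≲ mass μ
    0≲m = ∫-nonneg μ λ _ → 0≲1
    0≲w1 : 0# ≲ w * 1#
    0≲w1 = *-nonneg 0≲w 0≲1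
    w≈0 : w ≈ 0#
    w≈0 = trans (sym (*-identityʳ w)) (+-zeroˡ 0≲w1 0≲m null)

  -- Greedy extraction of mass from a measure

  record Extraction {A : Set a} (Q : Pred A b) (μ : Measure A) (m : Carrier)
                    : Set (a ⊔ b ⊔ c ⊔ ℓ₁ ⊔ ℓ₂) where
    field
      taken     : Measure (∃ Q)
      rest      : Measure A
      massTaken : mass taken ≈ m
      -- Ranging over all test functions, this says that `taken` and `rest` together are `μ`. The
      -- proofs of `Q` kept in `taken` are what allows a letter to be prepended.
      split     : ∀ φ → ∫ taken (φ ∘ proj₁) + ∫ rest φ ≈ ∫ μ φ

  module _ {A : Set a} {Q : Pred A b} where

    skip : ∀ (x : A × ∃[ w ] 0# ≲ w) {μ : Measure A} {m} → Extraction Q μ m → Extraction Q (x ∷ μ) m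
    skip x@(y , w , _) e = record
      { taken = taken ; rest = x ∷ rest ; massTaken = massTaken
      ; split = λ φ → trans (x∙yz≈y∙xz _ (w * φ y) _) (+-congˡ (split φ)) }
      where open Extraction e

    take : ∀ {x w} (q : Q x) (0≲w : 0# ≲ w) {μ : Measure A} {m n} → m ≈ w + n →
           Extraction Q μ n → Extraction Q ((x , w , 0≲w) ∷ μ) m
    take {x} {w} q 0≲w m≈w+n e = record
      { taken = ((x , q) , w , 0≲w) ∷ taken ; rest = rest
      ; massTaken = trans (+-cong (*-identityʳ w) massTaken) (sym m≈w+n)
      ; split = λ φ → trans (+-assoc (w * φ x) _ _) (+-congˡ (split φ)) }
      where open Extraction e

    takePart : ∀ {x w} (q : Q x) (0≲w : 0# ≲ w) {μ : Measure A} {m n} → 0# ≲ m → 0# ≲ n → w ≈ m + n →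
               Extraction Q ((x , w , 0≲w) ∷ μ) m
    takePart {x} {w} q 0≲w {μ} {m} {n} 0≲m 0≲n w≈m+n = record
      { taken = ((x , q) , m , 0≲m) ∷ [] ; rest = (x , n , 0≲n) ∷ μ
      ; massTaken = trans (+-identityʳ _) (*-identityʳ m)
      ; split = λ φ → begin-equality
          (m * φ x + 0#) + (n * φ x + ∫ μ φ) ≈⟨ +-congʳ (+-identityʳ _) ⟩
          m * φ x + (n * φ x + ∫ μ φ)        ≈⟨ +-assoc _ _ _ ⟨
          (m * φ x + n * φ x) + ∫ μ φ        ≈⟨ +-congʳ (distribʳ (φ x) m n) ⟨
          (m + n) * φ x + ∫ μ φ              ≈⟨ +-congʳ (*-congʳ w≈m+n) ⟨
          w * φ x + ∫ μ φ                    ∎ }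

    -- Atoms in `Q` are taken whole as long as they fit into the remaining demand; the first that
    -- does not fit is cut in two.
    extract : (Q? : Decidable Q) (μ : Measure A) → ∀ {m} →
              0# ≲ m → m ≲ ∫ μ (𝟙 ∘ Q?) → Extraction Q μ m
    extract Q? [] 0≲m m≲ = record
      { taken = [] ; rest = [] ; massTaken = antisym 0≲m m≲ ; split = λ _ → +-identityˡ 0# }
    extract Q? ((x , w , 0≲w) ∷ μ) {m} 0≲m m≲ with Q? x
    ... | no _ = skip _ (extract Q? μ 0≲m
      (≲-trans m≲ (≲-reflexive (trans (+-congʳ (zeroʳ w)) (+-identityˡ _)))))
    ... | yes q with ≲-total w m
    ...   | inj₂ m≲w = let _ , 0≲n , w≈m+n = difference m≲w in takePart q 0≲w 0≲m 0≲n w≈m+n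
    ...   | inj₁ w≲m with difference w≲m
    ...     | n , 0≲n , m≈w+n = take q 0≲w m≈w+n (extract Q? μ 0≲n (+-cancelˡ-≲ w (begin
      w + n                 ≈⟨ m≈w+n ⟨
      m                     ≤⟨ m≲ ⟩
      w * 1# + ∫ μ (𝟙 ∘ Q?) ≈⟨ +-congʳ (*-identityʳ w) ⟩
      w + ∫ μ (𝟙 ∘ Q?)      ∎)))

  Σ< : ℕ → (ℕ → Carrier) → Carrier
  Σ< zero    f = 0#
  Σ< (suc n) f = f n + Σ< n f

  Σ<-cong : ∀ n {f g} → (∀ i → i < n → f i ≈ g i) → Σ< n f ≈ Σ< n g
  Σ<-cong zero    eq = refl
  Σ<-cong (suc n) eq = +-cong (eq n ≤-refl) (Σ<-cong n λ i i<n → eq i (m≤n⇒m≤1+n i<n))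

  Σ<-zero : ∀ n {f} → (∀ i → i < n → f i ≈ 0#) → Σ< n f ≈ 0#
  Σ<-zero zero    eq = refl
  Σ<-zero (suc n) eq =
    trans (+-cong (eq n ≤-refl) (Σ<-zero n λ i i<n → eq i (m≤n⇒m≤1+n i<n))) (+-identityˡ 0#)

  -- One row: prepending a letter to a measure on words

  module _ {q k : ℕ} {X D : ℕ → Carrier} (0≲D : ∀ i → 0# ≲ D i) (D≲X : ∀ i → D i ≲ X i) where

    private
      fresh : ∀ {n} → n < q → (∃ λ (w : Word q k) → state w ≡ suc n) → Word q (suc k)
      fresh {n} n<q (word m v g , m≡1+n) =
        word n (fromℕ< n<q ∷ v) (new (toℕ-fromℕ< n<q) (≡.subst (λ m → Growing m v) m≡1+n g))

      repeated : ∀ {n} → n < q → (∃ λ (w : Word q k) → suc n ≤ state w) → Word q (suc k)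
      repeated {n} n<q (word m v g , n<m) =
        word m (fromℕ< n<q ∷ v) (old (≡.subst (_< m) (≡.sym (toℕ-fromℕ< n<q)) n<m) g)

    record Peeling (n : ℕ) (μ : Measure (Word q k)) : Set (c ⊔ ℓ₁ ⊔ ℓ₂) where
      field
        freshPart    : Measure (∃ λ w → state w ≡ suc n)
        repeatedPart : Measure (∃ λ w → suc n ≤ state w)
        rest         : Measure (Word q k)
        freshMass    : mass freshPart ≈ D n
        totalMass    : mass freshPart + mass repeatedPart ≈ X n
        split        : ∀ φ → (∫ freshPart (φ ∘ proj₁) + ∫ repeatedPart (φ ∘ proj₁)) + ∫ rest φ ≈ ∫ μ φ

      -- A test function that is constant on the states above `n` cannot see which words were taken.
      -- With `d = 0` this protects the fresh demands of smaller columns, with `d = 1` it updates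
      -- the tail bounds.
      split-const : ∀ {φ} d → (∀ w → n < state w → φ w ≈ d) → X n * d + ∫ rest φ ≈ ∫ μ φ
      split-const {φ} d eq = begin-equality
        X n * d + ∫ rest φ
          ≈⟨ +-congʳ (*-congʳ totalMass) ⟨
        (mass freshPart + mass repeatedPart) * d + ∫ rest φ
          ≈⟨ +-congʳ (distribʳ d _ _) ⟩
        (mass freshPart * d + mass repeatedPart * d) + ∫ rest φ
          ≈⟨ +-congʳ (+-cong (∫-const freshPart d) (∫-const repeatedPart d)) ⟨
        (∫ freshPart (λ _ → d) + ∫ repeatedPart (λ _ → d)) + ∫ rest φ
          ≈⟨ +-congʳ (+-cong (∫-cong freshPart λ (w , w≡) → eq w (≤-reflexive (≡.sym w≡)))
                             (∫-cong repeatedPart λ (w , n<w) → eq w n<w)) ⟨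
        (∫ freshPart (φ ∘ proj₁) + ∫ repeatedPart (φ ∘ proj₁)) + ∫ rest φ
          ≈⟨ split φ ⟩
        ∫ μ φ ∎

    -- Fresh mass goes first because it has a single source, the state `n + 1`, whereas repeated
    -- mass may come from any state above `n`.
    peel : ∀ n (μ : Measure (Word q k)) →
           D n ≲ ∫ μ (λ w → 𝟙 (state w ≟ suc n)) → X n ≲ ∫ μ (λ w → 𝟙 (suc n ≤? state w)) → Peeling n μ
    peel n μ freshFits fits = record
      { freshPart    = E₁.taken
      ; repeatedPart = E₂.taken
      ; rest         = E₂.rest
      ; freshMass    = E₁.massTaken
      ; totalMass    = trans (+-cong E₁.massTaken E₂.massTaken) (sym X≈D+z)
      ; split        = λ φ → trans (+-assoc _ _ _) (trans (+-congˡ (E₂.split φ)) (E₁.split φ))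
      }
      where
      z = proj₁ (difference (D≲X n))
      X≈D+z : X n ≈ D n + z
      X≈D+z = proj₂ (proj₂ (difference (D≲X n)))
      e₁ : Extraction (λ w → state w ≡ suc n) μ (D n)
      e₁ = extract (λ w → state w ≟ suc n) μ (0≲D n) freshFits
      module E₁ = Extraction e₁
      above : Word q k → Carrier
      above w = 𝟙 (suc n ≤? state w)
      0≲z : 0# ≲ z
      0≲z = proj₁ (proj₂ (difference (D≲X n)))
      -- The fresh words also lie above `n`, so they use up exactly `D n` of the supply for `X n`,
      -- and the remaining demand `z` still fits.
      e₂ : Extraction (λ w → suc n ≤ state w) E₁.rest z
      e₂ = extract (λ w → suc n ≤? state w) E₁.rest 0≲z (+-cancelˡ-≲ (D n) (begin
        D n + z                                         ≈⟨ X≈D+z ⟨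
        X n                                             ≤⟨ fits ⟩
        ∫ μ above                                       ≈⟨ E₁.split above ⟨
        ∫ E₁.taken (above ∘ proj₁) + ∫ E₁.rest above
          ≈⟨ +-congʳ (∫-cong E₁.taken λ (w , w≡) → []·-yes (suc n ≤? state w) (≤-reflexive (≡.sym w≡))) ⟩
        mass E₁.taken + ∫ E₁.rest above             ≈⟨ +-congʳ E₁.massTaken ⟩
        D n + ∫ E₁.rest above                         ∎))
      module E₂ = Extraction e₂

    record Extension (n : ℕ) (μ : Measure (Word q k)) : Set (c ⊔ ℓ₁ ⊔ ℓ₂) where
      field
        extended : Measure (Word q (suc k))
        rest     : Measure (Word q k)
        total    : mass extended ≈ Σ< n X
        heads    : ∀ l → ∫ extended (λ w → 𝟙 (toℕ (Vec.head (letters w)) ≟ l)) ≈ Σ< n (λ i → [ i ≟ l ]· X i)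
        -- Deleting the prepended letters gives back the mass that was used, so the marginals of the
        -- rows below survive.
        tails    : ∀ φ → ∫ extended (φ ∘ Vec.tail ∘ letters) + ∫ rest (φ ∘ letters) ≈ ∫ μ (φ ∘ letters)
        -- Prepending a fresh letter i lowers the state from i + 1 to i, which loses D i at m = i + 1.
        states   : ∀ m → (∫ extended (λ w → 𝟙 (m ≤? state w)) + Σ< n (λ i → [ suc i ≟ m ]· D i))
                         + ∫ rest (λ w → 𝟙 (m ≤? state w)) ≈ ∫ μ (λ w → 𝟙 (m ≤? state w))

    prepend : ∀ {n} → n < q → ∀ {μ} (p : Peeling n μ) → Extension n (Peeling.rest p) → Extension (suc n) μ
    prepend {n} n<q {μ} p e = record
      { extended = push (fresh n<q) freshPart ++ (push (repeated n<q) repeatedPart ++ extended)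
      ; rest     = Ex.rest
      ; total    = begin-equality
          _                                           ≈⟨ ∫-all (λ _ → 1#) ⟩
          (mass freshPart + mass repeatedPart) + mass extended ≈⟨ +-cong totalMass total ⟩
          X n + Σ< n X                                ∎
      ; heads    = λ l → begin-equality
          _ ≈⟨ ∫-all _ ⟩
          (∫ freshPart (λ _ → 𝟙 (toℕ (fromℕ< n<q) ≟ l)) + ∫ repeatedPart (λ _ → 𝟙 (toℕ (fromℕ< n<q) ≟ l))) + _
            ≈⟨ +-cong (+-cong (∫-const freshPart _) (∫-const repeatedPart _)) (heads l) ⟩
          (mass freshPart * 𝟙 (toℕ (fromℕ< n<q) ≟ l) + mass repeatedPart * 𝟙 (toℕ (fromℕ< n<q) ≟ l)) + _
            ≈⟨ +-congʳ (distribʳ _ _ _) ⟨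
          (mass freshPart + mass repeatedPart) * 𝟙 (toℕ (fromℕ< n<q) ≟ l) + _
            ≈⟨ +-congʳ (*-cong totalMass ([]·-⇔ (toℕ (fromℕ< n<q) ≟ l) (n ≟ l)
                 (≡.trans (≡.sym (toℕ-fromℕ< n<q))) (≡.trans (toℕ-fromℕ< n<q)))) ⟩
          X n * 𝟙 (n ≟ l) + _
            ≈⟨ +-congʳ (*-𝟙 (n ≟ l)) ⟩
          [ n ≟ l ]· X n + _ ∎
      ; tails    = λ φ → begin-equality
          _ ≈⟨ +-congʳ (∫-all _) ⟩
          _ ≈⟨ +-assoc _ _ _ ⟩
          _ ≈⟨ +-congˡ (tails φ) ⟩
          _ ≈⟨ split (φ ∘ letters) ⟩
          _ ∎
      ; states   = λ m → begin-equality
          _ ≈⟨ +-congʳ (+-congʳ (∫-all _)) ⟩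
          (((∫ freshPart (λ _ → 𝟙 (m ≤? n)) + repeatedAt m) + extendedAt m)
            + ([ suc n ≟ m ]· D n + freshAt m)) + restAt m
            ≈⟨ regroup (∫ freshPart (λ _ → 𝟙 (m ≤? n))) (repeatedAt m) (extendedAt m)
                       ([ suc n ≟ m ]· D n) (freshAt m) (restAt m) ⟩
          ((∫ freshPart (λ _ → 𝟙 (m ≤? n)) + [ suc n ≟ m ]· D n) + repeatedAt m)
            + ((extendedAt m + freshAt m) + restAt m)
            ≈⟨ +-cong (+-congʳ (freshStates m)) (states m) ⟩
          (∫ freshPart (λ (w , _) → 𝟙 (m ≤? state w)) + repeatedAt m) + ∫ Pl.rest (λ w → 𝟙 (m ≤? state w))
            ≈⟨ split _ ⟩
          ∫ μ (λ w → 𝟙 (m ≤? state w)) ∎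
      }
      where
      module Pl = Peeling p
      module Ex = Extension e
      open Pl hiding (rest)
      open Ex hiding (rest)
      repeatedAt extendedAt freshAt restAt : ℕ → Carrier
      repeatedAt m = ∫ repeatedPart (λ (w , _) → 𝟙 (m ≤? state w))
      extendedAt m = ∫ extended (λ w → 𝟙 (m ≤? state w))
      freshAt m = Σ< n (λ i → [ suc i ≟ m ]· D i)
      restAt m = ∫ Ex.rest (λ w → 𝟙 (m ≤? state w))
      ∫-all : ∀ φ → ∫ (push (fresh n<q) freshPart ++ (push (repeated n<q) repeatedPart ++ extended)) φ ≈
                    (∫ freshPart (φ ∘ fresh n<q) + ∫ repeatedPart (φ ∘ repeated n<q)) + ∫ extended φ
      ∫-all φ = begin-equality
        _ ≈⟨ ∫-++ (push (fresh n<q) freshPart) _ φ ⟩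
        _ ≈⟨ +-congˡ (∫-++ (push (repeated n<q) repeatedPart) _ φ) ⟩
        _ ≈⟨ +-assoc _ _ _ ⟨
        _ ≈⟨ +-congʳ (+-cong (∫-push (fresh n<q) freshPart φ) (∫-push (repeated n<q) repeatedPart φ)) ⟩
        _ ∎
      *-𝟙 : ∀ {Q : Set} {x} (Q? : Dec Q) → x * 𝟙 Q? ≈ [ Q? ]· x
      *-𝟙 (yes _) = *-identityʳ _
      *-𝟙 (no _)  = zeroʳ _
      regroup : ∀ f r e d s u → (((f + r) + e) + (d + s)) + u ≈ ((f + d) + r) + ((e + s) + u)
      regroup = solve 6 (λ f r e d s u →
        (((f :+ r) :+ e) :+ (d :+ s)) :+ u := ((f :+ d) :+ r) :+ ((e :+ s) :+ u)) refl
      freshStates : ∀ m → ∫ freshPart (λ _ → 𝟙 (m ≤? n)) + [ suc n ≟ m ]· D n ≈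
                          ∫ freshPart (λ (w , _) → 𝟙 (m ≤? state w))
      freshStates m = begin-equality
        ∫ freshPart (λ _ → 𝟙 (m ≤? n)) + [ suc n ≟ m ]· D n
          ≈⟨ +-cong (∫-const freshPart _) (trans (sym (*-𝟙 (suc n ≟ m))) (*-congʳ (sym freshMass))) ⟩
        mass freshPart * 𝟙 (m ≤? n) + mass freshPart * 𝟙 (suc n ≟ m)
          ≈⟨ distribˡ _ _ _ ⟨
        mass freshPart * (𝟙 (m ≤? n) + 𝟙 (suc n ≟ m))
          ≈⟨ *-congˡ (𝟙-⊎ (m ≤? n) (suc n ≟ m) (m ≤? suc n) m≤n⇒m≤1+n (λ eq → ≤-reflexive (≡.sym eq))
               (λ m≤1+n → case≤ (m≤n⇒m<n∨m≡n m≤1+n)) λ { (m≤n , ≡.refl) → 1+n≰n m≤n }) ⟩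
        mass freshPart * 𝟙 (m ≤? suc n)
          ≈⟨ ∫-const freshPart _ ⟨
        ∫ freshPart (λ _ → 𝟙 (m ≤? suc n))
          ≈⟨ ∫-cong freshPart (λ (w , w≡) → []·-⇔ (m ≤? suc n) (m ≤? state w)
               (≡.subst (m ≤_) (≡.sym w≡)) (≡.subst (m ≤_) w≡)) ⟩
        ∫ freshPart (λ (w , _) → 𝟙 (m ≤? state w)) ∎
        where
        case≤ : m < suc n ⊎ m ≡ suc n → m ≤ n ⊎ suc n ≡ m
        case≤ (inj₁ (s≤s m≤n)) = inj₁ m≤n
        case≤ (inj₂ eq)        = inj₂ (≡.sym eq)

    -- Serving the columns from right to left meets every demand: column l draws on states > l only,
    -- and its demand for state l + 1 is met before smaller columns are served.
    extend : ∀ n → n ≤ q → (μ : Measure (Word q k)) →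
             (∀ i → i < n → D i ≲ ∫ μ (λ w → 𝟙 (state w ≟ suc i))) →
             (∀ l → l < n → Σ< n (λ i → [ l ≤? i ]· X i) ≲ ∫ μ (λ w → 𝟙 (suc l ≤? state w))) →
             Extension n μ
    extend zero    _   μ _         _    = record
      { extended = [] ; rest = μ ; total = refl ; heads = λ _ → refl ; tails = λ _ → +-identityˡ _
      ; states = λ _ → trans (+-congʳ (+-identityˡ 0#)) (+-identityˡ _) }
    extend (suc n) n<q μ freshFits fits =
      prepend n<q peeled (extend n (≤-trans (n≤1+n n) n<q) Pl.rest
        (λ i i<n → begin
          D i ≤⟨ freshFits i (<-trans i<n (n<1+n n)) ⟩
          _   ≈⟨ Pl.split-const 0# (λ w n<w → []·-no (state w ≟ suc i) λ w≡ →
                   <⇒≢ (≤-trans (s≤s i<n) n<w) (≡.sym w≡)) ⟨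
          _   ≈⟨ trans (+-congʳ (zeroʳ _)) (+-identityˡ _) ⟩
          _   ∎)
        -- Demand and supply above `l` have both dropped by `X n`.
        (λ l l<n → +-cancelˡ-≲ (X n) (begin
          X n + Σ< n (λ i → [ l ≤? i ]· X i) ≈⟨ +-congʳ ([]·-yes (l ≤? n) (≤-trans (n≤1+n l) l<n)) ⟨
          _ ≤⟨ fits l (<-trans l<n (n<1+n n)) ⟩
          _ ≈⟨ Pl.split-const 1# (λ w n<w → []·-yes (suc l ≤? state w) (≤-trans l<n (≤-trans (n≤1+n n) n<w))) ⟨
          _ ≈⟨ +-congʳ (*-identityʳ _) ⟩
          _ ∎)))
      where
      peeled : Peeling n μ
      -- At `l = n` the tail sum in `fits` consists of `X n` alone.
      peeled = peel n μ (freshFits n ≤-refl) (begin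
        X n ≈⟨ +-identityʳ _ ⟨
        X n + 0# ≈⟨ +-cong ([]·-yes (n ≤? n) ≤-refl) (Σ<-zero n λ i i<n → []·-no (n ≤? i) (<⇒≱ i<n)) ⟨
        _ ≤⟨ fits n ≤-refl ⟩
        _ ∎)
      module Pl = Peeling peeled

  Σ<-delta : ∀ n (f : ℕ → Carrier) {l} → l < n → Σ< n (λ i → [ i ≟ l ]· f i) ≈ f l
  Σ<-delta (suc n) f {l} (s≤s l≤n) with m≤n⇒m<n∨m≡n l≤n
  ... | inj₁ l<n    = trans
    (+-cong ([]·-no (n ≟ l) λ n≡l → <⇒≢ l<n (≡.sym n≡l)) (Σ<-delta n f l<n)) (+-identityˡ _)
  ... | inj₂ ≡.refl = trans
    (+-cong ([]·-yes (n ≟ n) ≡.refl) (Σ<-zero n λ i i<n → []·-no (i ≟ n) (<⇒≢ i<n))) (+-identityʳ _)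

  Σ<-delta-vanishing : ∀ n (f : ℕ → Carrier) l → (∀ l → n ≤ l → f l ≈ 0#) → Σ< n (λ i → [ i ≟ l ]· f i) ≈ f l
  Σ<-delta-vanishing n f l vanishes with l <? n
  ... | yes l<n = Σ<-delta n f l<n
  ... | no  l≮n = trans (Σ<-zero n λ i i<n → []·-no (i ≟ l) λ i≡l → l≮n (≡.subst (_< n) i≡l i<n))
                        (sym (vanishes l (≮⇒≥ l≮n)))

  -- From a flow to a measure on words

  shift : (ℕ → Carrier) → ℕ → Carrier
  shift f zero    = 0#
  shift f (suc l) = f l

  -- The flow through the nodes (i,l) with l ≥ m, as a function of the diagonal arcs.
  upper : (ℕ → ℕ → Carrier) → ℕ → ℕ → Carrier
  upper D zero    m = 𝟙 (m ≟ 0)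
  upper D (suc i) m = upper D i m + shift (D i) m

  upper-zero : ∀ D i → upper D i 0 ≈ 1#
  upper-zero D zero    = refl
  upper-zero D (suc i) = trans (+-identityʳ _) (upper-zero D i)

  upper-suc : ∀ D i l → upper D i (suc l) ≈ Σ< i (λ k → D k l)
  upper-suc D zero    l = refl
  upper-suc D (suc i) l = trans (+-congʳ (upper-suc D i l)) (+-comm _ _)

  -- Coordinates run over all of ℕ, which removes the ragged index ranges. The right-hand side of
  -- `bar-bound` equals `upper D (suc i) (suc l)`, the mass in states above `l` after row `i`.
  record Fractional (p q : ℕ) (X D V : ℕ → ℕ → Carrier) : Set (c ⊔ ℓ₁ ⊔ ℓ₂) where
    field
      D-nonneg   : ∀ i l → 0# ≲ D i l
      V-nonneg   : ∀ i l → 0# ≲ V i l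
      D≲X        : ∀ i l → D i l ≲ X i l
      X-vanishes : ∀ i l → q ≤ l → X i l ≈ 0#
      row-total  : ∀ {i} → i < p → Σ< q (X i) ≈ 1#
      bar-bound  : ∀ {i l} → i < p → l < q → Σ< q (λ j → [ l ≤? j ]· X i j) ≲ Σ< (suc i) (λ k → D k l)
      -- Flow through row `i` in columns `≥ m` either goes straight down at `m` or arrives in
      -- columns `≥ m + 1` of the next row, and nothing else arrives there.
      descent    : ∀ {i} → i < p → ∀ m → upper D i m ≈ upper D (suc i) (suc m) + V i m

  -- A nonincreasing `u` is the tail function of the measure with atom `u m - u (m + 1)` at each
  -- `m`. Only finitely many atoms are allowed, so the tail from `n` on is cut off.
  telescope : ∀ (u : ℕ → Carrier) → (∀ m → u (suc m) ≲ u m) → ∀ n → Σ[ μ ∈ Measure ℕ ]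
              (∀ m → m ≤ n → ∫ μ (λ x → 𝟙 (m ≤? x)) + u n ≈ u m) × (∀ m → n ≤ m → ∫ μ (λ x → 𝟙 (m ≤? x)) ≈ 0#)
  telescope u decreasing zero    = [] , (λ { _ z≤n → +-identityˡ _ }) , λ _ _ → refl
  telescope u decreasing (suc n) with telescope u decreasing n | difference (decreasing n)
  ... | μ , below , above | z , 0≲z , un≈ = (n , z , 0≲z) ∷ μ , below′ , above′
    where
    above′ : ∀ m → suc n ≤ m → z * 𝟙 (m ≤? n) + ∫ μ (λ x → 𝟙 (m ≤? x)) ≈ 0#
    above′ m n<m = begin-equality
      z * 𝟙 (m ≤? n) + ∫ μ (λ x → 𝟙 (m ≤? x))
        ≈⟨ +-cong (*-congˡ ([]·-no (m ≤? n) (<⇒≱ n<m))) (above m (<⇒≤ n<m)) ⟩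
      z * 0# + 0#
        ≈⟨ trans (+-identityʳ _) (zeroʳ z) ⟩
      0# ∎
    below′ : ∀ m → m ≤ suc n → (z * 𝟙 (m ≤? n) + ∫ μ (λ x → 𝟙 (m ≤? x))) + u (suc n) ≈ u m
    below′ m m≤1+n with m≤n⇒m<n∨m≡n m≤1+n
    ... | inj₂ ≡.refl      = trans (+-congʳ (above′ m ≤-refl)) (+-identityˡ _)
    ... | inj₁ (s≤s m≤n) = begin-equality
      (z * 𝟙 (m ≤? n) + ∫ μ (λ x → 𝟙 (m ≤? x))) + u (suc n)
        ≈⟨ +-congʳ (+-congʳ (trans (*-congˡ ([]·-yes (m ≤? n) m≤n)) (*-identityʳ z))) ⟩
      (z + ∫ μ (λ x → 𝟙 (m ≤? x))) + u (suc n)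
        ≈⟨ solve 3 (λ z i u → (z :+ i) :+ u := i :+ (u :+ z)) refl z _ _ ⟩
      ∫ μ (λ x → 𝟙 (m ≤? x)) + (u (suc n) + z)
        ≈⟨ +-congˡ un≈ ⟨
      ∫ μ (λ x → 𝟙 (m ≤? x)) + u n
        ≈⟨ below m m≤n ⟩
      u m ∎

  -- Induction over the rows, from the last to the first

  module _ {p q : ℕ} {X D V : ℕ → ℕ → Carrier} (fractional : Fractional p q X D V) where
    open Fractional fractional

    private
      U : ℕ → ℕ → Carrier
      U = upper D

      D-vanishes : ∀ i l → q ≤ l → D i l ≈ 0#
      D-vanishes i l q≤l = antisym (≲-trans (D≲X i l) (≲-reflexive (X-vanishes i l q≤l))) (D-nonneg i l)

      shift-nonneg : ∀ i m → 0# ≲ shift (D i) m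
      shift-nonneg i zero    = ≲-refl
      shift-nonneg i (suc l) = D-nonneg i l

      U-decreasing : ∀ i → i ≤ p → ∀ m → U i (suc m) ≲ U i m
      U-decreasing zero    _   m = 𝟙-nonneg (m ≟ 0)
      U-decreasing (suc i) i<p m = begin
        U (suc i) (suc m)         ≤⟨ x≲x+y (V-nonneg i m) ⟩
        U (suc i) (suc m) + V i m ≈⟨ descent i<p m ⟨
        U i m                     ≤⟨ x≲x+y (shift-nonneg i m) ⟩
        U (suc i) m               ∎

      U-vanishes : ∀ i m → q < m → U i m ≈ 0#
      U-vanishes i (suc l) (s≤s q≤l) = trans (upper-suc D i l) (Σ<-zero i λ k _ → D-vanishes k l q≤l)

    record RowMeasure (k i : ℕ) : Set (c ⊔ ℓ₁ ⊔ ℓ₂) where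
      field
        measure   : Measure (Word q k)
        states    : ∀ m → ∫ measure (λ w → 𝟙 (m ≤? state w)) ≈ U i m
        marginals : ∀ r l → ∫ measure (λ w → 𝟙 (toℕ (Vec.lookup (letters w) r) ≟ l)) ≈ X (i ℕ.+ toℕ r) l

    lastRow : RowMeasure 0 p
    -- No state exceeds `q`: `U p` vanishes at `q + 1`, so cutting off there loses nothing.
    lastRow with telescope (U p) (U-decreasing p ≤-refl) (suc q)
    ... | μ , below , above = record
      { measure   = push (λ m → word m [] []) μ
      ; states    = λ m → trans (∫-push _ μ _) (states m)
      ; marginals = λ () }
      where
      states : ∀ m → ∫ μ (λ x → 𝟙 (m ≤? x)) ≈ U p m
      states m with ≤-total m (suc q)
      ... | inj₂ q<m   = trans (above m q<m) (sym (U-vanishes p m q<m))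
      ... | inj₁ m≤1+q = trans
        (sym (trans (+-congˡ (U-vanishes p (suc q) ≤-refl)) (+-identityʳ _))) (below m m≤1+q)

    previousRow : ∀ {k i} → i < p → RowMeasure k (suc i) → RowMeasure (suc k) i
    previousRow {k} {i} i<p μ = record
      { measure   = extended
      -- `U (suc i) m` unfolds to `U i m + shift (D i) m`; cancelling the loss caused by fresh
      -- letters leaves `U i m`.
      ; states    = λ m → +-cancelʳ (shift (D i) m) _ _ (begin-equality
          ∫ extended (λ w → 𝟙 (m ≤? state w)) + shift (D i) m
            ≈⟨ +-identityʳ _ ⟨
          (∫ extended (λ w → 𝟙 (m ≤? state w)) + shift (D i) m) + 0#
            ≈⟨ +-cong (+-congˡ (delta m)) (∫-null rest _ rest-null) ⟨
          _ ≈⟨ states m ⟩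
          _ ≈⟨ Rm.states m ⟩
          U (suc i) m ∎)
      ; marginals = marginals }
      where
      module Rm = RowMeasure μ
      -- At state l + 1 there is the mass V i (l + 1) + D i l flowing into the node (i + 1, l + 1).
      fresh : ∀ l → l < q → D i l ≲ ∫ Rm.measure (λ w → 𝟙 (state w ≟ suc l))
      fresh l _ = ≲-trans (x≲y+x (V-nonneg i (suc l))) (≲-reflexive
        (+-cancelˡ (U (suc i) (suc (suc l))) _ _ (begin-equality
        U (suc i) (suc (suc l)) + (V i (suc l) + D i l)
          ≈⟨ +-assoc _ _ _ ⟨
        (U (suc i) (suc (suc l)) + V i (suc l)) + D i l
          ≈⟨ +-congʳ (descent i<p (suc l)) ⟨
        U (suc i) (suc l)
          ≈⟨ Rm.states (suc l) ⟨
        ∫ Rm.measure (λ w → 𝟙 (suc l ≤? state w))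
          ≈⟨ ∫-cong Rm.measure (λ w → 𝟙-⊎ (suc (suc l) ≤? state w) (state w ≟ suc l) (suc l ≤? state w)
               <⇒≤ (λ eq → ≤-reflexive (≡.sym eq)) (λ le → case≤ (m≤n⇒m<n∨m≡n le))
               (λ (lt , eq) → <⇒≢ lt (≡.sym eq))) ⟨
        ∫ Rm.measure (λ w → 𝟙 (suc (suc l) ≤? state w) + 𝟙 (state w ≟ suc l))
          ≈⟨ ∫-+ Rm.measure _ _ ⟩
        ∫ Rm.measure (λ w → 𝟙 (suc (suc l) ≤? state w)) + ∫ Rm.measure (λ w → 𝟙 (state w ≟ suc l))
          ≈⟨ +-congʳ (Rm.states (suc (suc l))) ⟩
        U (suc i) (suc (suc l)) + ∫ Rm.measure (λ w → 𝟙 (state w ≟ suc l)) ∎)))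
        where
        case≤ : ∀ {x y} → x < y ⊎ x ≡ y → x < y ⊎ y ≡ x
        case≤ (inj₁ lt) = inj₁ lt
        case≤ (inj₂ eq) = inj₂ (≡.sym eq)
      fits : ∀ l → l < q → Σ< q (λ j → [ l ≤? j ]· X i j) ≲ ∫ Rm.measure (λ w → 𝟙 (suc l ≤? state w))
      fits l l<q = ≲-trans (bar-bound i<p l<q)
        (≲-reflexive (trans (sym (upper-suc D (suc i) l)) (sym (Rm.states (suc l)))))
      open Extension (extend (D-nonneg i) (D≲X i) q ≤-refl Rm.measure fresh fits)
      delta : ∀ m → Σ< q (λ l → [ suc l ≟ m ]· D i l) ≈ shift (D i) m
      delta zero    = Σ<-zero q λ _ _ → refl
      delta (suc m) = trans
        (Σ<-cong q λ l _ → []·-⇔ (suc l ≟ suc m) (l ≟ m) suc-injective (≡.cong suc))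
        (Σ<-delta-vanishing q (D i) m (D-vanishes i))
      -- The words have total mass 1 and the demands of the row add up to 1, so every word, up to
      -- mass 0, has received a letter.
      rest-null : mass rest ≈ 0#
      rest-null = +-cancelˡ (mass extended) _ _ (begin-equality
        mass extended + mass rest ≈⟨ tails (λ _ → 1#) ⟩
        mass Rm.measure           ≈⟨ Rm.states 0 ⟩
        U (suc i) 0               ≈⟨ upper-zero D (suc i) ⟩
        1#                        ≈⟨ row-total i<p ⟨
        Σ< q (X i)                ≈⟨ total ⟨
        mass extended             ≈⟨ +-identityʳ _ ⟨
        mass extended + 0#        ∎)
      marginals : ∀ r l → ∫ extended (λ w → 𝟙 (toℕ (Vec.lookup (letters w) r) ≟ l)) ≈ X (i ℕ.+ toℕ r) l
      marginals zero l = begin-equality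
        _ ≈⟨ ∫-cong extended (λ { (word _ (_ ∷ _) _) → refl }) ⟩
        _ ≈⟨ heads l ⟩
        _ ≈⟨ Σ<-delta-vanishing q (X i) l (X-vanishes i) ⟩
        X i l ≡⟨ ≡.cong (λ j → X j l) (ℕ-+-identityʳ i) ⟨
        _ ∎
      marginals (suc r) l = begin-equality
        _ ≈⟨ ∫-cong extended (λ { (word _ (_ ∷ _) _) → refl }) ⟩
        ∫ extended (φ ∘ Vec.tail ∘ letters)                         ≈⟨ +-identityʳ _ ⟨
        ∫ extended (φ ∘ Vec.tail ∘ letters) + 0#                    ≈⟨ +-congˡ (∫-null rest _ rest-null) ⟨
        ∫ extended (φ ∘ Vec.tail ∘ letters) + ∫ rest (φ ∘ letters)  ≈⟨ tails φ ⟩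
        ∫ Rm.measure (φ ∘ letters)                                  ≈⟨ Rm.marginals r l ⟩
        X (suc i ℕ.+ toℕ r) l                                       ≡⟨ ≡.cong (λ j → X j l) (+-suc i (toℕ r)) ⟨
        X (i ℕ.+ suc (toℕ r)) l                                     ∎
        where
        φ : Vec (Fin q) k → Carrier
        φ v = 𝟙 (toℕ (Vec.lookup v r) ≟ l)

    rowMeasure : ∀ k i → i ℕ.+ k ≡ p → RowMeasure k i
    rowMeasure zero    i eq = ≡.subst (RowMeasure 0) (≡.trans (≡.sym eq) (ℕ-+-identityʳ i)) lastRow
    rowMeasure (suc k) i eq =
      previousRow (≤-trans (m≤m+n (suc i) k) (≤-reflexive eq′)) (rowMeasure k (suc i) eq′)
      where
      eq′ : suc i ℕ.+ k ≡ p
      eq′ = ≡.trans (≡.sym (+-suc i k)) eq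

    rounding : Σ[ μ ∈ Measure (∃ λ (v : Vec (Fin q) p) → Growing 0 v) ] mass μ ≈ 1# ×
               (∀ r l → ∫ μ (λ (v , _) → 𝟙 (toℕ (Vec.lookup v r) ≟ l)) ≈ X (toℕ r) l)
    rounding = push initial taken , trans (∫-push initial taken _) massTaken , marginals′
      where
      open RowMeasure (rowMeasure p 0 ≡.refl)
      initial : (∃ λ (w : Word q p) → state w ≡ 0) → ∃ λ (v : Vec (Fin q) p) → Growing 0 v
      initial (word _ v g , ≡.refl) = v , g
      -- The flow starts in the node `(0,0)`: the tail `upper D 0 1` is 0, hence all mass sits in
      -- state 0.
      atZero : ∫ measure (λ w → 𝟙 (state w ≟ 0)) ≈ 1#
      atZero = begin-equality
        ∫ measure (λ w → 𝟙 (state w ≟ 0))           ≈⟨ +-identityʳ _ ⟨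
        ∫ measure (λ w → 𝟙 (state w ≟ 0)) + 0#      ≈⟨ +-congˡ (states 1) ⟨
        ∫ measure (λ w → 𝟙 (state w ≟ 0)) + ∫ measure (λ w → 𝟙 (1 ≤? state w)) ≈⟨ ∫-+ measure _ _ ⟨
        ∫ measure (λ w → 𝟙 (state w ≟ 0) + 𝟙 (1 ≤? state w)) ≈⟨ ∫-cong measure (λ w → one (state w)) ⟩
        mass measure                                ≈⟨ states 0 ⟩
        1#                                          ∎
        where
        one : ∀ m → 𝟙 (m ≟ 0) + 𝟙 (1 ≤? m) ≈ 1#
        one zero    = +-identityʳ 1#
        one (suc m) = +-identityˡ 1#
      open Extraction (extract (λ w → state w ≟ 0) measure 0≲1 (≲-reflexive (sym atZero)))
      rest-null : mass rest ≈ 0#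
      rest-null = +-cancelˡ 1# _ _ (begin-equality
        1# + mass rest         ≈⟨ +-congʳ massTaken ⟨
        mass taken + mass rest ≈⟨ split (λ _ → 1#) ⟩
        mass measure           ≈⟨ states 0 ⟩
        1#                     ≈⟨ +-identityʳ 1# ⟨
        1# + 0#                ∎)
      marginals′ : ∀ r l → ∫ (push initial taken) (λ (v , _) → 𝟙 (toℕ (Vec.lookup v r) ≟ l)) ≈ X (toℕ r) l
      marginals′ r l = begin-equality
        _ ≈⟨ ∫-push initial taken _ ⟩
        _ ≈⟨ ∫-cong taken (λ { (word _ _ _ , ≡.refl) → refl }) ⟩
        ∫ taken (φ ∘ proj₁)              ≈⟨ +-identityʳ _ ⟨
        ∫ taken (φ ∘ proj₁) + 0#         ≈⟨ +-congˡ (∫-null rest φ rest-null) ⟨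
        ∫ taken (φ ∘ proj₁) + ∫ rest φ   ≈⟨ split φ ⟩
        ∫ measure φ                      ≈⟨ marginals r l ⟩
        X (toℕ r) l                      ∎
        where
        φ : Word q p → Carrier
        φ w = 𝟙 (toℕ (Vec.lookup (letters w) r) ≟ l)

  open import Algebra.Properties.Monoid.Sum +-monoid using (sum; sum-cong-≋)

  sum-zero : ∀ {n} {g : Fin n → Carrier} → (∀ i → g i ≈ 0#) → sum g ≈ 0#
  sum-zero {zero}  eq = refl
  sum-zero {suc n} eq = trans (+-cong (eq zero) (sum-zero (eq ∘ suc))) (+-identityˡ 0#)

  sum-[]· : ∀ {n} {Q : Set a} (Q? : Dec Q) (g : Fin n → Carrier) → sum (λ i → [ Q? ]· g i) ≈ [ Q? ]· sum g
  sum-[]· (yes _) g = refl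
  sum-[]· {n = n} (no _) g = sum-zero {n} λ _ → refl

  sum-guard : ∀ {n} {Q : Fin n → Set a} {S : Set b} (Q? : ∀ j → Dec (Q j)) (S? : Dec S)
              (g : Fin n → Carrier) {x} →
              (∀ j → Q j → S) → (S → sum (λ j → [ Q? j ]· g j) ≈ x) → sum (λ j → [ Q? j ]· g j) ≈ [ S? ]· x
  sum-guard Q? (yes u) g Q⇒S eq = eq u
  sum-guard Q? (no ¬u) g Q⇒S eq = sum-zero λ j → []·-no (Q? j) (¬u ∘ Q⇒S j)

  -- Evaluation of the sums over arcs and cells

  -- Extension by zero lets missing arcs and cells count as carrying 0, so that balance equations
  -- and row sums need no case distinction at the borders.
  ext : ∀ n → (Fin n → Carrier) → ℕ → Carrier
  ext zero    g k       = 0#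
  ext (suc n) g zero    = g zero
  ext (suc n) g (suc k) = ext n (g ∘ suc) k

  ext-toℕ : ∀ {n} (g : Fin n → Carrier) i → ext n g (toℕ i) ≈ g i
  ext-toℕ g zero    = refl
  ext-toℕ g (suc i) = ext-toℕ (g ∘ suc) i

  ext-cong : ∀ {n} {g h : Fin n → Carrier} → (∀ i → g i ≈ h i) → ∀ k → ext n g k ≈ ext n h k
  ext-cong {zero}  eq k       = refl
  ext-cong {suc n} eq zero    = eq zero
  ext-cong {suc n} eq (suc k) = ext-cong (eq ∘ suc) k

  ext-mono : ∀ {n} {g h : Fin n → Carrier} → (∀ i → g i ≲ h i) → ∀ k → ext n g k ≲ ext n h k
  ext-mono {zero}  le k       = ≲-refl
  ext-mono {suc n} le zero    = le zero
  ext-mono {suc n} le (suc k) = ext-mono (le ∘ suc) k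

  ext-vanishes : ∀ {n} (g : Fin n → Carrier) {k} → n ≤ k → ext n g k ≈ 0#
  ext-vanishes {zero}  g _         = refl
  ext-vanishes {suc n} g (s≤s n≤k) = ext-vanishes (g ∘ suc) n≤k

  ext-zero : ∀ {n} {g : Fin n → Carrier} → (∀ i → g i ≈ 0#) → ∀ k → ext n g k ≈ 0#
  ext-zero {zero}  eq k       = refl
  ext-zero {suc n} eq zero    = eq zero
  ext-zero {suc n} eq (suc k) = ext-zero (eq ∘ suc) k

  ext-nonneg : ∀ {n} {g : Fin n → Carrier} → (∀ i → 0# ≲ g i) → ∀ k → 0# ≲ ext n g k
  ext-nonneg {zero}  le k       = ≲-refl
  ext-nonneg {suc n} le zero    = le zero
  ext-nonneg {suc n} le (suc k) = ext-nonneg (le ∘ suc) k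

  ext-restrict : ∀ n (h : ℕ → Carrier) {k} → k < n → ext n (h ∘ toℕ) k ≈ h k
  ext-restrict (suc n) h {zero}  _         = refl
  ext-restrict (suc n) h {suc k} (s≤s k<n) = ext-restrict n (h ∘ suc) k<n

  ext-∘ : ∀ {n} (f : ℕ → Carrier → Carrier) → (∀ k → f k 0# ≈ 0#) → (g : Fin n → Carrier) → ∀ k →
          ext n (λ i → f (toℕ i) (g i)) k ≈ f k (ext n g k)
  ext-∘ {zero}  f f0 g k       = sym (f0 k)
  ext-∘ {suc n} f f0 g zero    = refl
  ext-∘ {suc n} f f0 g (suc k) = ext-∘ (f ∘ suc) (f0 ∘ suc) (g ∘ suc) k

  sum-delta : ∀ {n} (g : Fin n → Carrier) k → sum (λ i → [ toℕ i ≟ k ]· g i) ≈ ext n g k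
  sum-delta {zero}  g k       = refl
  sum-delta {suc n} g zero    = trans (+-congˡ (sum-zero {n} λ _ → refl)) (+-identityʳ _)
  sum-delta {suc n} g (suc k) = trans (+-identityˡ _) (sum-delta (g ∘ suc) k)

  Σ<-front : ∀ n (f : ℕ → Carrier) → Σ< (suc n) f ≈ f 0 + Σ< n (f ∘ suc)
  Σ<-front zero    f = refl
  Σ<-front (suc n) f = trans (+-congˡ (Σ<-front n f)) (x∙yz≈y∙xz _ _ _)

  sum-below : ∀ {n} (g : Fin n → Carrier) r → sum (λ i → [ toℕ i <? r ]· g i) ≈ Σ< r (ext n g)
  sum-below {zero}  g r       = sym (Σ<-zero r λ _ _ → refl)
  sum-below {suc n} g zero    = sum-zero {suc n} λ _ → refl
  sum-below {suc n} g (suc r) = begin-equality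
    g zero + sum (λ i → [ suc (toℕ i) <? suc r ]· g (suc i))
      ≈⟨ +-congˡ (sum-cong-≋ {n} λ i → []·-⇔ (suc (toℕ i) <? suc r) (toℕ i <? r) ≤-pred s≤s) ⟩
    g zero + sum (λ i → [ toℕ i <? r ]· g (suc i))
      ≈⟨ +-congˡ (sum-below (g ∘ suc) r) ⟩
    g zero + Σ< r (ext n (g ∘ suc))
      ≈⟨ Σ<-front r (ext (suc n) g) ⟨
    Σ< (suc r) (ext (suc n) g) ∎

  sum-bounded : ∀ {n q} → n ≤ q → (g : Fin n → Carrier) → sum g ≈ Σ< q (ext n g)
  sum-bounded {n} {q} n≤q g = trans
    (sum-cong-≋ {n} λ i → sym ([]·-yes (toℕ i <? q) (≤-trans (toℕ<n i) n≤q)))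
    (sum-below g q)

  ext₂ : ∀ {p} (n : Fin p → ℕ) → (∀ i → Fin (n i) → Carrier) → ℕ → ℕ → Carrier
  ext₂ n g k l = ext _ (λ i → ext (n i) (g i) l) k

  sum-delta₂ : ∀ {p} {n : Fin p → ℕ} (g : ∀ i → Fin (n i) → Carrier) k l
               {R : ∀ i → Fin (n i) → Set b} (R? : ∀ i j → Dec (R i j)) →
               (∀ i j → R i j → toℕ i ≡ k × toℕ j ≡ l) → (∀ i j → toℕ i ≡ k → toℕ j ≡ l → R i j) →
               sum (λ i → sum (λ j → [ R? i j ]· g i j)) ≈ ext₂ n g k l
  sum-delta₂ {p = p} {n = n} g k l R? to from = begin-equality
    sum (λ i → sum (λ j → [ R? i j ]· g i j))
      ≈⟨ sum-cong-≋ (λ i → sum-cong-≋ (λ j → nested (R? i j) (toℕ i ≟ k) (toℕ j ≟ l) (to i j) (from i j))) ⟩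
    sum (λ i → sum (λ j → [ toℕ i ≟ k ]· [ toℕ j ≟ l ]· g i j))
      ≈⟨ sum-cong-≋ (λ i → trans (sum-[]· (toℕ i ≟ k) (λ j → [ toℕ j ≟ l ]· g i j))
                                 ([]·-cong (toℕ i ≟ k) (sum-delta (g i) l))) ⟩
    sum (λ i → [ toℕ i ≟ k ]· ext (n i) (g i) l)
      ≈⟨ sum-delta (λ i → ext (n i) (g i) l) k ⟩
    ext₂ n g k l ∎
    where
    nested : ∀ {Q : Set b} {S T : Set} (Q? : Dec Q) (S? : Dec S) (T? : Dec T) → (Q → S × T) → (S → T → Q) →
             ∀ {x} → [ Q? ]· x ≈ [ S? ]· [ T? ]· x
    nested Q? (yes u) (yes v) to from = []·-yes Q? (from u v)
    nested Q? (yes u) (no ¬v) to from = []·-no Q? (¬v ∘ proj₂ ∘ to)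
    nested Q? (no ¬u) T?      to from = []·-no Q? (¬u ∘ proj₁ ∘ to)

  Σᴸ : List E → (E → Carrier) → Carrier
  Σᴸ es z = foldr _+_ 0# (map z es)

  sumOver-[]· : ∀ (es : List E) (z : E → Carrier) {N : Pred E b} (N? : Decidable N) →
                sumOver K es z N? ≈ Σᴸ es (λ e → [ N? e ]· z e)
  sumOver-[]· []       z N? = refl
  sumOver-[]· (e ∷ es) z N? with N? e
  ... | yes _ = +-congˡ (sumOver-[]· es z N?)
  ... | no _  = trans (sumOver-[]· es z N?) (sym (+-identityˡ _))

  Σᴸ-++ : ∀ (es fs : List E) z → Σᴸ (es ++ fs) z ≈ Σᴸ es z + Σᴸ fs z
  Σᴸ-++ []       fs z = sym (+-identityˡ _)
  Σᴸ-++ (e ∷ es) fs z = trans (+-congˡ (Σᴸ-++ es fs z)) (sym (+-assoc _ _ _))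

  Σᴸ-map-tabulate : ∀ {A : Set a} {E : Set b} {n} (f : A → E) (h : Fin n → A) z →
                    Σᴸ (map f (tabulate h)) z ≈ sum (z ∘ f ∘ h)
  Σᴸ-map-tabulate {n = zero}  f h z = refl
  Σᴸ-map-tabulate {n = suc n} f h z = +-congˡ (Σᴸ-map-tabulate f (h ∘ suc) z)

  Σᴸ-concatMap-tabulate : ∀ {A : Set a} {E : Set b} {n} (f : A → List E) (h : Fin n → A) z →
                          Σᴸ (concatMap f (tabulate h)) z ≈ sum (λ i → Σᴸ (f (h i)) z)
  Σᴸ-concatMap-tabulate {n = zero}  f h z = refl
  Σᴸ-concatMap-tabulate {n = suc n} f h z =
    trans (Σᴸ-++ (f (h zero)) _ z) (+-congˡ (Σᴸ-concatMap-tabulate f (h ∘ suc) z))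

  Σᴸ-pairs : ∀ {E : Set b} {p} {n : Fin p → ℕ} (f : ∀ i → Fin (n i) → E) z →
             Σᴸ (concatMap (λ i → map (f i) (allFin (n i))) (allFin p)) z ≈ sum (λ i → sum (λ j → z (f i j)))
  Σᴸ-pairs {p = p} {n = n} f z = trans (Σᴸ-concatMap-tabulate (λ i → map (f i) (allFin (n i))) id z)
                       (sum-cong-≋ λ i → Σᴸ-map-tabulate (f i) id z)

  module _ {p q : ℕ} where

    Σᴸ-arcs : ∀ z → Σᴸ (arcs {p} {q}) z ≈
                    sum (λ i → sum (λ j → z (vertical i j))) +
                    (sum (λ i → sum (λ j → z (diagonal i j))) + (z source + sum (λ j → z (sink j))))
    Σᴸ-arcs z = begin-equality
      _ ≈⟨ Σᴸ-++ (concatMap (λ i → map (vertical i) (allFin _)) (allFin p)) _ z ⟩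
      _ ≈⟨ +-cong (Σᴸ-pairs vertical z) (Σᴸ-++ (concatMap (λ i → map (diagonal i) (allFin _)) (allFin p)) _ z) ⟩
      _ ≈⟨ +-congˡ (+-cong (Σᴸ-pairs diagonal z) (+-congˡ (Σᴸ-map-tabulate sink id z))) ⟩
      _ ∎

    node-injective : ∀ {i j k l} .{a : i ≤ p} .{b : j ≤ q ⟨ i ⟩} .{c : k ≤ p} .{d : l ≤ q ⟨ k ⟩} →
                     node {p} {q} i j a b ≡ node k l c d → i ≡ k × j ≡ l
    node-injective ≡.refl = ≡.refl , ≡.refl

    node-cong : ∀ {i j k l} .{a : i ≤ p} .{b : j ≤ q ⟨ i ⟩} .{c : k ≤ p} .{d : l ≤ q ⟨ k ⟩} →
                i ≡ k → j ≡ l → node {p} {q} i j a b ≡ node k l c d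
    node-cong ≡.refl ≡.refl = ≡.refl

    module ArcSums (y : Arc p q → Carrier) where

      V D : ℕ → ℕ → Carrier
      V = ext₂ _ (λ i j → y (vertical i j))
      D = ext₂ _ (λ i j → y (diagonal i j))

      T : ℕ → Carrier
      T = ext _ (λ j → y (sink j))

      select : ∀ {N : Pred (Arc p q) b} (N? : Decidable N) → sumOver K arcs y N? ≈
               sum (λ i → sum (λ j → [ N? (vertical i j) ]· y (vertical i j))) +
               (sum (λ i → sum (λ j → [ N? (diagonal i j) ]· y (diagonal i j))) +
                ([ N? source ]· y source + sum (λ j → [ N? (sink j) ]· y (sink j))))
      select N? = trans (sumOver-[]· arcs y N?) (Σᴸ-arcs _)

      module _ {N : Pred (Arc p q) b} (N? : Decidable N) where

        no-vertical : (∀ i j → ¬ N (vertical i j)) →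
                      sum (λ i → sum (λ j → [ N? (vertical i j) ]· y (vertical i j))) ≈ 0#
        no-vertical ¬N = sum-zero λ i → sum-zero λ j → []·-no (N? (vertical i j)) (¬N i j) {y (vertical i j)}

        no-diagonal : (∀ i j → ¬ N (diagonal i j)) →
                      sum (λ i → sum (λ j → [ N? (diagonal i j) ]· y (diagonal i j))) ≈ 0#
        no-diagonal ¬N = sum-zero λ i → sum-zero λ j → []·-no (N? (diagonal i j)) (¬N i j)

        no-sink : (∀ j → ¬ N (sink j)) → sum (λ j → [ N? (sink j) ]· y (sink j)) ≈ 0#
        no-sink ¬N = sum-zero λ j → []·-no (N? (sink j)) (¬N j) {y (sink j)}

      -- `shift` accounts for column 0, which no diagonal arc enters.
      inflow-suc : ∀ k l .(k<p : suc k ≤ p) .(l≤ : l ≤ q ⟨ suc k ⟩) →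
                   inflow K p q y (node (suc k) l k<p l≤) ≈ V k l + shift (D k) l
      inflow-suc k l k<p l≤ = begin-equality
        _ ≈⟨ select (λ a → head a ≟ᴺ v) ⟩
        _ ≈⟨ +-cong
               (sum-delta₂ (λ i j → y (vertical i j)) k l (λ i j → head (vertical i j) ≟ᴺ v)
                 (λ i j eq → suc-injective (proj₁ (node-injective eq)) , proj₂ (node-injective eq))
                 (λ i j eq eq′ → node-cong (≡.cong suc eq) eq′))
               (+-cong (diagonals l l≤)
                 (+-cong ([]·-no (head source ≟ᴺ v) (λ ()) {y source}) (no-sink (λ a → head a ≟ᴺ v) λ j ()))) ⟩
        V k l + (shift (D k) l + (0# + 0#))
          ≈⟨ +-congˡ (trans (+-congˡ (+-identityˡ 0#)) (+-identityʳ _)) ⟩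
        V k l + shift (D k) l ∎
        where
        v : Node p q
        v = node (suc k) l k<p l≤
        diagonals : ∀ l .(l≤ : l ≤ q ⟨ suc k ⟩) →
                    sum (λ i → sum (λ j → [ head (diagonal i j) ≟ᴺ node (suc k) l k<p l≤ ]· y (diagonal i j)))
                    ≈ shift (D k) l
        diagonals zero    l≤ = no-diagonal (λ a → head a ≟ᴺ node (suc k) zero k<p l≤) λ i j ()
        diagonals (suc l) l≤ = sum-delta₂ (λ i j → y (diagonal i j)) k l
          (λ i j → head (diagonal i j) ≟ᴺ node (suc k) (suc l) k<p l≤)
          (λ i j eq → suc-injective (proj₁ (node-injective eq)) , suc-injective (proj₂ (node-injective eq)))
          (λ i j eq eq′ → node-cong (≡.cong suc eq) (≡.cong suc eq′))

      inflow-zero : ∀ l .(0≤p : 0 ≤ p) .(l≤ : l ≤ q ⟨ 0 ⟩) →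
                    inflow K p q y (node 0 l 0≤p l≤) ≈ [ l ≟ 0 ]· y source
      inflow-zero l 0≤p l≤ = begin-equality
        _ ≈⟨ select (λ a → head a ≟ᴺ v) ⟩
        _ ≈⟨ +-cong (no-vertical (λ a → head a ≟ᴺ v) λ i j ())
               (+-cong (no-diagonal (λ a → head a ≟ᴺ v) λ i j ())
                 (+-cong ([]·-⇔ (head source ≟ᴺ v) (l ≟ 0)
                   (λ eq → ≡.sym (proj₂ (node-injective eq))) (λ { ≡.refl → ≡.refl }))
                   (no-sink (λ a → head a ≟ᴺ v) λ j ()))) ⟩
        0# + (0# + ([ l ≟ 0 ]· y source + 0#))
          ≈⟨ trans (+-identityˡ _) (trans (+-identityˡ _) (+-identityʳ _)) ⟩
        [ l ≟ 0 ]· y source ∎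
        where
        v : Node p q
        v = node 0 l 0≤p l≤

      -- One formula serves all rows: in row `p` the zero extensions remove `V` and `D`, elsewhere
      -- the guard removes the sink arc.
      outflow-node : ∀ k l .(k≤p : k ≤ p) .(l≤ : l ≤ q ⟨ k ⟩) →
                     outflow K p q y (node k l k≤p l≤) ≈ (V k l + D k l) + [ p ≟ k ]· T l
      outflow-node k l k≤p l≤ = begin-equality
        _ ≈⟨ select (λ a → tail a ≟ᴺ v) ⟩
        _ ≈⟨ +-cong
               (sum-delta₂ (λ i j → y (vertical i j)) k l (λ i j → tail (vertical i j) ≟ᴺ v)
                 (λ i j → node-injective) (λ i j → node-cong))
               (+-cong
                 (sum-delta₂ (λ i j → y (diagonal i j)) k l (λ i j → tail (diagonal i j) ≟ᴺ v)
                   (λ i j → node-injective) (λ i j → node-cong))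
                 (+-cong ([]·-no (tail source ≟ᴺ v) (λ ()) {y source}) sinks)) ⟩
        V k l + (D k l + (0# + [ p ≟ k ]· T l))
          ≈⟨ trans (+-congˡ (+-congˡ (+-identityˡ _))) (sym (+-assoc _ _ _)) ⟩
        (V k l + D k l) + [ p ≟ k ]· T l ∎
        where
        v : Node p q
        v = node k l k≤p l≤
        sinks : sum (λ j → [ tail (sink j) ≟ᴺ v ]· y (sink j)) ≈ [ p ≟ k ]· T l
        sinks = sum-guard (λ j → tail (sink j) ≟ᴺ v) (p ≟ k) (λ j → y (sink j))
          (λ j → proj₁ ∘ node-injective) λ p≡k → trans
          (sum-cong-≋ λ j → []·-⇔ (tail (sink j) ≟ᴺ v) (toℕ j ≟ l)
            (proj₂ ∘ node-injective) (node-cong p≡k) {y (sink j)})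
          (sum-delta (λ j → y (sink j)) l)

      outflow-s : outflow K p q y s ≈ y source
      outflow-s = begin-equality
        _ ≈⟨ select (λ a → tail a ≟ᴺ s) ⟩
        _ ≈⟨ +-cong (no-vertical (λ a → tail a ≟ᴺ s) λ i j ())
             (+-cong (no-diagonal (λ a → tail a ≟ᴺ s) λ i j ())
              (+-congˡ (no-sink (λ a → tail a ≟ᴺ s) λ j ()))) ⟩
        0# + (0# + (y source + 0#))
          ≈⟨ trans (+-identityˡ _) (trans (+-identityˡ _) (+-identityʳ _)) ⟩
        y source ∎

      in↘-col : ∀ e → sumOver K arcs y (in↘? (col? e)) ≈ Σ< (rowOf e) (λ k → D k (toℕ (col₀ e)))
      in↘-col e = begin-equality
        _ ≈⟨ select N? ⟩
        _ ≈⟨ +-cong (no-vertical N? λ { i j (() , _) })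
               (+-cong (sum-cong-≋ λ i → column-sum i)
                 (+-cong ([]·-no (N? source) (λ { (() , _) }) {y source}) (no-sink N? λ { j (() , _) }))) ⟩
        0# + (sum (λ i → [ toℕ i <? rowOf e ]· ext _ (λ j → y (diagonal i j)) l) + (0# + 0#))
          ≈⟨ trans (+-identityˡ _) (trans (+-congˡ (+-identityˡ 0#)) (+-identityʳ _)) ⟩
        sum (λ i → [ toℕ i <? rowOf e ]· ext _ (λ j → y (diagonal i j)) l)
          ≈⟨ sum-below (λ i → ext _ (λ j → y (diagonal i j)) l) (rowOf e) ⟩
        Σ< (rowOf e) (λ k → D k l) ∎
        where
        l : ℕ
        l = toℕ (col₀ e)
        N? : Decidable (In↘ (Col e))
        N? = in↘? (col? e)
        to : ∀ i j → In↘ (Col e) (diagonal i j) → toℕ i < rowOf e × toℕ j ≡ l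
        to i j (_ , (j≡l , _ , i<row) , _) = i<row , suc-injective j≡l
        from : ∀ i j → toℕ i < rowOf e → toℕ j ≡ l → In↘ (Col e) (diagonal i j)
        -- The head is not above the main diagonal because the arc exists, and the tail lies one
        -- column to the left, hence outside `Col e`.
        from i j i<row j≡l = isDiagonal ,
          (≡.cong suc j≡l , ≡.subst (λ l → suc l ≤ suc (toℕ i)) j≡l (≤-trans (toℕ<n j) (m⊓n≤m _ q)) , i<row) ,
          λ (j≡1+l , _) → 1+n≢n (≡.trans (≡.sym j≡1+l) j≡l)
        column-sum : ∀ i → sum (λ j → [ N? (diagonal i j) ]· y (diagonal i j)) ≈
                           [ toℕ i <? rowOf e ]· ext _ (λ j → y (diagonal i j)) l
        column-sum i = sum-guard (λ j → N? (diagonal i j)) (toℕ i <? rowOf e) (λ j → y (diagonal i j))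
          (λ j → proj₁ ∘ to i j) λ i<row → trans
          (sum-cong-≋ λ j → []·-⇔ (N? (diagonal i j)) (toℕ j ≟ l) (proj₂ ∘ to i j) (from i j i<row))
          (sum-delta (λ j → y (diagonal i j)) l)

    module CellSums (x : Cell p q → Carrier) where

      X : ℕ → ℕ → Carrier
      X = ext₂ _ (λ i j → x (cell i j))

      X-toℕ : ∀ i l → X (toℕ i) l ≈ ext _ (λ j → x (cell i j)) l
      X-toℕ i l = ext-toℕ (λ i → ext _ (λ j → x (cell i j)) l) i


      select-row : ∀ {N : Pred (Cell p q) b} (N? : Decidable N) r {R : ℕ → Set} (R? : Decidable R) →
                   (∀ i j → N (cell i j) → i ≡ r × R (toℕ j)) → (∀ j → R (toℕ j) → N (cell r j)) →
                   sumOver K cells x N? ≈ Σ< q (λ l → [ R? l ]· X (toℕ r) l)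
      select-row N? r R? to from = begin-equality
        _ ≈⟨ sumOver-[]· cells x N? ⟩
        _ ≈⟨ Σᴸ-pairs cell (λ e → [ N? e ]· x e) ⟩
        sum (λ i → sum (λ j → [ N? (cell i j) ]· x (cell i j)))
          ≈⟨ sum-cong-≋ row ⟩
        sum (λ i → [ toℕ i ≟ toℕ r ]· sum (λ j → [ R? (toℕ j) ]· x (cell i j)))
          ≈⟨ sum-delta (λ i → sum (λ j → [ R? (toℕ j) ]· x (cell i j))) (toℕ r) ⟩
        ext _ (λ i → sum (λ j → [ R? (toℕ j) ]· x (cell i j))) (toℕ r)
          ≈⟨ ext-toℕ (λ i → sum (λ j → [ R? (toℕ j) ]· x (cell i j))) r ⟩
        sum (λ j → [ R? (toℕ j) ]· x (cell r j))
          ≈⟨ sum-bounded (m⊓n≤n (suc (toℕ r)) q) _ ⟩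
        Σ< q (ext _ (λ j → [ R? (toℕ j) ]· x (cell r j)))
          ≈⟨ Σ<-cong q (λ l _ → trans (ext-∘ (λ l → [ R? l ]·_) (λ l → []·-zero (R? l) λ _ → refl)
                                             (λ j → x (cell r j)) l)
                                      ([]·-cong (R? l) (sym (X-toℕ r l)))) ⟩
        Σ< q (λ l → [ R? l ]· X (toℕ r) l) ∎
        where
        row : ∀ i → sum (λ j → [ N? (cell i j) ]· x (cell i j)) ≈
                    [ toℕ i ≟ toℕ r ]· sum (λ j → [ R? (toℕ j) ]· x (cell i j))
        sameRow : ∀ i → i ≡ r →
                  sum (λ j → [ N? (cell i j) ]· x (cell i j)) ≈ sum (λ j → [ R? (toℕ j) ]· x (cell i j))
        sameRow i ≡.refl = sum-cong-≋ λ j → []·-⇔ (N? (cell r j)) (R? (toℕ j)) (proj₂ ∘ to r j) (from j)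
        row i = sum-guard (λ j → N? (cell i j)) (toℕ i ≟ toℕ r) (λ j → x (cell i j))
                          (λ j → ≡.cong toℕ ∘ proj₁ ∘ to i j) (sameRow i ∘ toℕ-injective)

      bar-sum : ∀ e → sumOver K cells x (bar? e) ≈ Σ< q (λ l → [ toℕ (col₀ e) ≤? l ]· X (toℕ (row₀ e)) l)
      bar-sum e = select-row (bar? e) (row₀ e) (toℕ (col₀ e) ≤?_)
        (λ i j (i≡ , le) → toℕ-injective (suc-injective i≡) , ≤-pred le) (λ j le → ≡.refl , s≤s le)

      row-sum : ∀ i → sumOver K cells x (row? i) ≈ Σ< q (X (toℕ i))
      row-sum i = trans
        (select-row (row? i) i (0 ≤?_) (λ k j eq → eq , z≤n) (λ j _ → ≡.refl))
        (Σ<-cong q λ l _ → refl)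

  -- The two inclusions

  ∫-as-sum : ∀ (μ : Measure A) φ → ∫ μ φ ≈ sum (λ k → proj₁ (proj₂ (lookup μ k)) * φ (proj₁ (lookup μ k)))
  ∫-as-sum []      φ = refl
  ∫-as-sum (_ ∷ μ) φ = +-congˡ (∫-as-sum μ φ)

  ∫-tabulate : ∀ {n} (h : Fin n → A × Σ[ w ∈ Carrier ] 0# ≲ w) φ →
               ∫ (tabulate h) φ ≈ sum (λ k → proj₁ (proj₂ (h k)) * φ (proj₁ (h k)))
  ∫-tabulate {n = zero}  h φ = refl
  ∫-tabulate {n = suc n} h φ = +-congˡ (∫-tabulate (h ∘ suc) φ)

  ∫-Σ< : ∀ (μ : Measure A) n (φ : ℕ → A → Carrier) → Σ< n (λ l → ∫ μ (φ l)) ≈ ∫ μ (λ x → Σ< n (λ l → φ l x))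
  ∫-Σ< μ zero    φ = sym (∫-zero μ λ _ → refl)
  ∫-Σ< μ (suc n) φ = trans (+-congˡ (∫-Σ< μ n φ)) (sym (∫-+ μ (φ n) _))

  Σ<-nonneg : ∀ n {f} → (∀ i → 0# ≲ f i) → 0# ≲ Σ< n f
  Σ<-nonneg zero    0≲f = ≲-refl
  Σ<-nonneg (suc n) 0≲f = +-nonneg (0≲f n) (Σ<-nonneg n 0≲f)

  ext-vanishes-at : ∀ {n} (g : Fin n → Carrier) k → (∀ i → toℕ i ≡ k → g i ≈ 0#) → ext n g k ≈ 0#
  ext-vanishes-at {zero}  g k       eq = refl
  ext-vanishes-at {suc n} g zero    eq = eq zero ≡.refl
  ext-vanishes-at {suc n} g (suc k) eq = ext-vanishes-at (g ∘ suc) k λ i i≡k → eq (suc i) (≡.cong suc i≡k)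

  ext-restrict-vanishing : ∀ n (h : ℕ → Carrier) k → (n ≤ k → h k ≈ 0#) → ext n (h ∘ toℕ) k ≈ h k
  ext-restrict-vanishing n h k vanishes with k <? n
  ... | yes k<n = ext-restrict n h k<n
  ... | no  k≮n = trans (ext-vanishes (h ∘ toℕ) (≮⇒≥ k≮n)) (sym (vanishes (≮⇒≥ k≮n)))

  atIndex : ∀ {p} {ℓ} (R : ℕ → Set ℓ) → (∀ (r : Fin p) → R (toℕ r)) → ∀ {i} → i < p → R i
  atIndex R all i<p = ≡.subst R (toℕ-fromℕ< i<p) (all (fromℕ< i<p))

  module _ {p q : ℕ} (0<p : 0 < p) where

    -- From a point of the extended formulation to a convex combination

    module _ {x : Cell p q → Carrier} {y : Arc p q → Carrier} (x,y∈P⁼ : P⁼ K p q x y) where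
      open P⁼ x,y∈P⁼
      open P inP
      open F flow
      open ArcSums y
      open CellSums x

      private
        V-vanishes : ∀ k l → q ⟨ k ⟩ < l → V k l ≈ 0#
        V-vanishes k l lt = ext-vanishes-at _ k λ i i≡k →
          ext-vanishes (λ j → y (vertical i j)) (≡.subst (λ k → q ⟨ k ⟩ < l) (≡.sym i≡k) lt)

        D-vanishes : ∀ k l → q ⟨ suc k ⟩ ≤ l → D k l ≈ 0#
        D-vanishes k l le = ext-vanishes-at _ k λ i i≡k →
          ext-vanishes (λ j → y (diagonal i j)) (≡.subst (λ k → q ⟨ suc k ⟩ ≤ l) (≡.sym i≡k) le)

        -- Where `(k,l)` is not a node, no diagonal arc leaves it: `q ⟨ suc k ⟩` exceeds `q ⟨ k ⟩`
        -- by at most one.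
        ⟨suc⟩≤ : ∀ {k l} → q ⟨ k ⟩ < l → q ⟨ suc k ⟩ ≤ l
        ⟨suc⟩≤ {k} lt = ≤-trans (⊓-monoʳ-≤ (suc k) (n≤1+n q)) lt

        outflow-inner : ∀ {k l} (k<p : k < p) (l≤ : l ≤ q ⟨ k ⟩) →
                        outflow K p q y (node k l (<⇒≤ k<p) l≤) ≈ V k l + D k l
        outflow-inner {k} {l} k<p l≤ = trans (outflow-node k l _ _)
          (trans (+-congˡ ([]·-no (p ≟ k) (λ p≡k → <⇒≢ k<p (≡.sym p≡k)))) (+-identityʳ _))

        source-balance : ∀ m → 𝟙 (m ≟ 0) ≈ V 0 m + D 0 m
        source-balance zero = begin-equality
          1#                     ≈⟨ trans (sym outflow-s) unitValue ⟨
          y source               ≈⟨ inflow-zero 0 z≤n z≤n ⟨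
          inflow K p q y origin  ≈⟨ conservation origin (λ ()) (λ ()) ⟩
          outflow K p q y origin ≈⟨ outflow-inner 0<p z≤n ⟩
          V 0 0 + D 0 0          ∎
          where
          origin : Node p q
          origin = node 0 0 z≤n z≤n
        source-balance (suc m) = sym (trans (+-cong (V-vanishes 0 (suc m) (s≤s z≤n))
          (D-vanishes 0 (suc m) (⟨suc⟩≤ {0} (s≤s z≤n)))) (+-identityˡ 0#))

        balance : ∀ k m → suc k < p → V k m + shift (D k) m ≈ V (suc k) m + D (suc k) m
        balance k m k<p with m ≤? q ⟨ suc k ⟩
        ... | yes m≤ = begin-equality
          V k m + shift (D k) m     ≈⟨ inflow-suc k m (<⇒≤ k<p) m≤ ⟨
          inflow K p q y (node (suc k) m (<⇒≤ k<p) m≤)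
                                    ≈⟨ conservation (node (suc k) m (<⇒≤ k<p) m≤) (λ ()) (λ ()) ⟩
          outflow K p q y (node (suc k) m (<⇒≤ k<p) m≤)
                                    ≈⟨ outflow-inner k<p m≤ ⟩
          V (suc k) m + D (suc k) m ∎
        ... | no m≰ = trans
          (trans (+-cong (V-vanishes k m (≤-<-trans (⊓-monoˡ-≤ q (n≤1+n k)) (≰⇒> m≰)))
                         (shift-vanishes m (≰⇒> m≰))) (+-identityˡ 0#))
          (sym (trans (+-cong (V-vanishes (suc k) m (≰⇒> m≰))
                              (D-vanishes (suc k) m (⟨suc⟩≤ {suc k} (≰⇒> m≰)))) (+-identityˡ 0#)))
          where
          shift-vanishes : ∀ m → q ⟨ suc k ⟩ < m → shift (D k) m ≈ 0#
          shift-vanishes (suc l) (s≤s le) = D-vanishes k l le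

      fractional : Fractional p q X D V
      fractional = record
        { D-nonneg   = λ i l → ext-nonneg (λ i → ext-nonneg (λ j → nonneg (diagonal i j)) l) i
        ; V-nonneg   = λ i l → ext-nonneg (λ i → ext-nonneg (λ j → nonneg (vertical i j)) l) i
        ; D≲X        = λ i l → ext-mono (λ i → ext-mono (λ j → condA (cell i j)) l) i
        ; X-vanishes = λ i l q≤l →
            ext-zero (λ i → ext-vanishes (λ j → x (cell i j)) (≤-trans (m⊓n≤n (suc (toℕ i)) q) q≤l)) i
        ; row-total  = atIndex (λ i → Σ< q (X i) ≈ 1#) λ r → trans (sym (row-sum r)) (rowSums r)
        ; bar-bound  = λ {_} {l} i<p _ →
            atIndex (λ i → Σ< q (λ j → [ l ≤? j ]· X i j) ≲ Σ< (suc i) (λ k → D k l)) (bars l) i<p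
        ; descent    = descends _
        }
        where
        bars : ∀ l r → Σ< q (λ j → [ l ≤? j ]· X (toℕ r) j) ≲ Σ< (suc (toℕ r)) (λ k → D k l)
        bars l r with l <? q ⟨ suc (toℕ r) ⟩
        ... | yes l< = atIndex (λ l → Σ< q (λ j → [ l ≤? j ]· X (toℕ r) j) ≲ Σ< (suc (toℕ r)) (λ k → D k l))
          (λ j → begin
            _ ≈⟨ bar-sum (cell r j) ⟨
            _ ≤⟨ condB (cell r j) ⟩
            _ ≈⟨ in↘-col (cell r j) ⟩
            _ ∎) l<
        -- Here row `r` has no cell in column `l`, so (b) says nothing, but the bar is empty.
        ... | no l≮ = begin
          _  ≈⟨ Σ<-zero q (λ j _ → []·-zero (l ≤? j) λ l≤j → trans (X-toℕ r j)
                  (ext-vanishes (λ j → x (cell r j)) (≤-trans (≮⇒≥ l≮) l≤j))) ⟩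
          0# ≤⟨ Σ<-nonneg (suc (toℕ r)) (λ k → ext-nonneg (λ i → ext-nonneg (λ j → nonneg (diagonal i j)) l) k) ⟩
          _  ∎
        -- Passing to the next row, conservation at the node `(i + 1, m)` trades what enters it for
        -- what leaves it.
        descends : ∀ i → i < p → ∀ m → upper D i m ≈ upper D (suc i) (suc m) + V i m
        descends zero    i<p m = begin-equality
          𝟙 (m ≟ 0)            ≈⟨ source-balance m ⟩
          V 0 m + D 0 m        ≈⟨ +-comm _ _ ⟩
          D 0 m + V 0 m        ≈⟨ +-congʳ (+-identityˡ _) ⟨
          (0# + D 0 m) + V 0 m ∎
        descends (suc i) i<p m = begin-equality
          upper D i m + shift (D i) m
            ≈⟨ +-congʳ (descends i (<⇒≤ i<p) m) ⟩
          (upper D (suc i) (suc m) + V i m) + shift (D i) m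
            ≈⟨ +-assoc _ _ _ ⟩
          upper D (suc i) (suc m) + (V i m + shift (D i) m)
            ≈⟨ +-congˡ (trans (balance i m i<p) (+-comm _ _)) ⟩
          upper D (suc i) (suc m) + (D (suc i) m + V (suc i) m)
            ≈⟨ +-assoc _ _ _ ⟨
          (upper D (suc i) (suc m) + D (suc i) m) + V (suc i) m ∎

      projP⁼⇒O⁼ : O⁼ K p q x
      projP⁼⇒O⁼ with rounding fractional
      -- A point of the hull also has entries above the diagonal; the letter marginals of `μ` supply
      -- them.
      ... | μ , mass-μ , marginals = (λ (i , j) → ∫ μ (λ (v , _) → 𝟙 (Vec.lookup v i ≟ᶠ j))) , record
        { size    = length μ
        ; point   = λ k (i , j) → 𝟙 (Vec.lookup (proj₁ (proj₁ (lookup μ k))) i ≟ᶠ j)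
        ; weight  = λ k → proj₁ (proj₂ (lookup μ k))
        ; point∈S = λ k →
            matrix (proj₁ (proj₁ (lookup μ k))) , growing⇒orbitope (proj₂ (proj₁ (lookup μ k))) , λ i j → refl
        ; nonneg  = λ k → proj₂ (proj₂ (lookup μ k))
        ; total   = trans (sum-cong-≋ {length μ} λ k → sym (*-identityʳ _)) (trans (sym (∫-as-sum μ _)) mass-μ)
        ; combine = λ (i , j) → ∫-as-sum μ _
        } , λ { (cell i j) → begin-equality
          x (cell i j)                                             ≈⟨ ext-toℕ (λ j → x (cell i j)) j ⟨
          ext _ (λ j → x (cell i j)) (toℕ j)                       ≈⟨ X-toℕ i (toℕ j) ⟨
          X (toℕ i) (toℕ j)                                        ≈⟨ marginals i (toℕ j) ⟨
          ∫ μ (λ (v , _) → 𝟙 (toℕ (Vec.lookup v i) ≟ toℕ j))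
            ≈⟨ ∫-cong μ (λ (v , _) → []·-⇔ (toℕ (Vec.lookup v i) ≟ toℕ j)
                 (Vec.lookup v i ≟ᶠ inject≤ j (m⊓n≤n _ q))
                 (λ eq → toℕ-injective (≡.trans eq (≡.sym (toℕ-inject≤ j _))))
                 (λ eq → ≡.trans (≡.cong toℕ eq) (toℕ-inject≤ j _))) ⟩
          ∫ μ (λ (v , _) → 𝟙 (Vec.lookup v i ≟ᶠ inject≤ j (m⊓n≤n _ q))) ∎ }

    -- The flow of a measure on words

    module _ (μ : Measure (∃ λ (v : Vec (Fin q) p) → Growing 0 v)) (mass-μ : mass μ ≈ 1#)
             (x : Cell p q → Carrier)
             (x-marginal : ∀ i j → x (cell i j) ≈ ∫ μ (λ (v , _) → 𝟙 (toℕ (Vec.lookup v i) ≟ toℕ j))) where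

      private
        σ : (∃ λ (v : Vec (Fin q) p) → Growing 0 v) → ℕ → ℕ
        σ (_ , g) = stateAt g

        letter : (∃ λ (v : Vec (Fin q) p) → Growing 0 v) → Fin p → ℕ
        letter (v , _) i = toℕ (Vec.lookup v i)

        stepAt : ∀ w i → Step (letter w i) (σ w (toℕ i)) (σ w (suc (toℕ i)))
        stepAt (_ , g) = step g

        vert diag stay : ℕ → ℕ → Carrier
        vert k l = ∫ μ (λ w → 𝟙 ((σ w k ≟ l) ×-dec (σ w (suc k) ≟ l)))
        diag k l = ∫ μ (λ w → 𝟙 ((σ w k ≟ l) ×-dec (σ w (suc k) ≟ suc l)))
        stay k l = ∫ μ (λ w → 𝟙 (σ w k ≟ l))

      pathFlow : Arc p q → Carrier
      pathFlow (vertical i j) = vert (toℕ i) (toℕ j)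
      pathFlow (diagonal i j) = diag (toℕ i) (toℕ j)
      pathFlow source         = 1#
      pathFlow (sink j)       = stay p (toℕ j)

      open ArcSums pathFlow
      open CellSums x

      private
        σ≢ : ∀ w k {l} → q ⟨ k ⟩ < l → ¬ (σ w k ≡ l)
        σ≢ (_ , g) k lt eq = <⇒≱ lt (≡.subst (_≤ q ⟨ k ⟩) eq (stateAt≤⊓ g k))

        V≈vert : ∀ {k} → k < p → ∀ l → V k l ≈ vert k l
        V≈vert k<p l = atIndex (λ k → V k l ≈ vert k l) (λ r → trans
          (ext-toℕ (λ i → ext _ (λ j → pathFlow (vertical i j)) l) r)
          (ext-restrict-vanishing (suc (q ⟨ toℕ r ⟩)) (vert (toℕ r)) l λ lt →
            ∫-zero μ λ w → []·-no ((σ w (toℕ r) ≟ l) ×-dec (σ w (suc (toℕ r)) ≟ l))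
                               (σ≢ w (toℕ r) lt ∘ proj₁))) k<p

        D≈diag : ∀ {k} → k < p → ∀ l → D k l ≈ diag k l
        D≈diag k<p l = atIndex (λ k → D k l ≈ diag k l) (λ r → trans
          (ext-toℕ (λ i → ext _ (λ j → pathFlow (diagonal i j)) l) r)
          (ext-restrict-vanishing (q ⟨ suc (toℕ r) ⟩) (diag (toℕ r)) l λ le →
            ∫-zero μ λ w → []·-no ((σ w (toℕ r) ≟ l) ×-dec (σ w (suc (toℕ r)) ≟ suc l))
                               (σ≢ w (suc (toℕ r)) (s≤s le) ∘ proj₂))) k<p

        T≈stay : ∀ l → T l ≈ stay p l
        T≈stay l = ext-restrict-vanishing (suc (q ⟨ p ⟩)) (stay p) l λ lt →
          ∫-zero μ λ w → []·-no (σ w p ≟ l) (σ≢ w p lt)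

        X≈marginal : ∀ i l → X (toℕ i) l ≈ ∫ μ (λ w → 𝟙 (letter w i ≟ l))
        X≈marginal i l = begin-equality
          X (toℕ i) l                    ≈⟨ X-toℕ i l ⟩
          ext _ (λ j → x (cell i j)) l   ≈⟨ ext-cong (x-marginal i) l ⟩
          ext (q ⟨ suc (toℕ i) ⟩) (marginal ∘ toℕ) l
            ≈⟨ ext-restrict-vanishing (q ⟨ suc (toℕ i) ⟩) marginal l (λ le →
                 ∫-zero μ λ w → []·-no (letter w i ≟ l) (letter≢ w le)) ⟩
          marginal l                     ∎
          where
          marginal : ℕ → Carrier
          marginal l = ∫ μ (λ w → 𝟙 (letter w i ≟ l))
          letter≢ : ∀ w → q ⟨ suc (toℕ i) ⟩ ≤ l → ¬ (letter w i ≡ l)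
          letter≢ w@(_ , g) le eq =
            <⇒≢ (<-≤-trans (<-≤-trans (letter<state (stepAt w i)) (stateAt≤⊓ g (suc (toℕ i)))) le) eq

        -- Each step uses exactly one of the two arcs that leave its node; `join` is the counterpart
        -- for entering arcs. Conservation follows, since both totals are the mass of the words
        -- through the node.
        fork : ∀ {k} → k < p → ∀ l → vert k l + diag k l ≈ stay k l
        fork k<p l = atIndex (λ k → vert k l + diag k l ≈ stay k l) (λ r →
          trans (sym (∫-+ μ _ _)) (∫-cong μ λ w → 𝟙-⊎
            ((σ w (toℕ r) ≟ l) ×-dec (σ w (suc (toℕ r)) ≟ l))
            ((σ w (toℕ r) ≟ l) ×-dec (σ w (suc (toℕ r)) ≟ suc l))
            (σ w (toℕ r) ≟ l)
            proj₁ proj₁ (λ eq → cases (stepAt w r) eq) λ ((_ , eq) , (_ , eq′)) → 1+n≢n (≡.trans (≡.sym eq′) eq))) k<p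
          where
          cases : ∀ {a m m′} → Step a m m′ → m ≡ l → (m ≡ l × m′ ≡ l) ⊎ (m ≡ l × m′ ≡ suc l)
          cases (stays eq′ _) eq = inj₁ (eq , ≡.trans eq′ eq)
          cases (advances eq′ _)    eq = inj₂ (eq , ≡.trans eq′ (≡.cong suc eq))

        join : ∀ {k} → k < p → ∀ l → vert k l + shift (diag k) l ≈ stay (suc k) l
        join k<p zero = atIndex (λ k → vert k 0 + 0# ≈ stay (suc k) 0) (λ r →
          trans (+-identityʳ _) (∫-cong μ λ w → []·-⇔
            ((σ w (toℕ r) ≟ 0) ×-dec (σ w (suc (toℕ r)) ≟ 0))
            (σ w (suc (toℕ r)) ≟ 0) proj₂ λ eq → cases (stepAt w r) eq , eq)) k<p
          where
          cases : ∀ {a m m′} → Step a m m′ → m′ ≡ 0 → m ≡ 0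
          cases (stays eq′ _) eq = ≡.trans (≡.sym eq′) eq
          cases (advances ≡.refl _) ()
        join k<p (suc l) = atIndex (λ k → vert k (suc l) + diag k l ≈ stay (suc k) (suc l)) (λ r →
          trans (sym (∫-+ μ _ _)) (∫-cong μ λ w → 𝟙-⊎
            ((σ w (toℕ r) ≟ suc l) ×-dec (σ w (suc (toℕ r)) ≟ suc l))
            ((σ w (toℕ r) ≟ l) ×-dec (σ w (suc (toℕ r)) ≟ suc l))
            (σ w (suc (toℕ r)) ≟ suc l)
            proj₂ proj₂ (λ eq → cases (stepAt w r) eq) λ ((eq , _) , (eq′ , _)) → 1+n≢n (≡.trans (≡.sym eq) eq′))) k<p
          where
          cases : ∀ {a m m′} → Step a m m′ → m′ ≡ suc l → (m ≡ suc l × m′ ≡ suc l) ⊎ (m ≡ l × m′ ≡ suc l)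
          cases (stays eq′ _) eq = inj₁ (≡.trans (≡.sym eq′) eq , eq)
          cases (advances eq′ _)    eq = inj₂ (suc-injective (≡.trans (≡.sym eq′) eq) , eq)

        outflow≈stay : ∀ k l .(k≤p : k ≤ p) .(l≤ : l ≤ q ⟨ k ⟩) →
                       outflow K p q pathFlow (node k l k≤p l≤) ≈ stay k l
        -- The bounds inside `node` are irrelevant; decidability turns them into a proof that can be
        -- analysed.
        outflow≈stay k l k≤p l≤ with m≤n⇒m<n∨m≡n (recompute (k ≤? p) k≤p)
        ... | inj₁ k<p = begin-equality
          _                                ≈⟨ outflow-node k l k≤p l≤ ⟩
          (V k l + D k l) + [ p ≟ k ]· T l
            ≈⟨ +-cong (+-cong (V≈vert k<p l) (D≈diag k<p l))
                      ([]·-no (p ≟ k) (λ p≡k → <⇒≢ k<p (≡.sym p≡k))) ⟩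
          (vert k l + diag k l) + 0#       ≈⟨ +-identityʳ _ ⟩
          vert k l + diag k l              ≈⟨ fork k<p l ⟩
          stay k l                         ∎
        ... | inj₂ ≡.refl = begin-equality
          _                                ≈⟨ outflow-node k l k≤p l≤ ⟩
          (V p l + D p l) + [ p ≟ p ]· T l
            ≈⟨ +-cong (+-cong (ext-vanishes {p} _ ≤-refl) (ext-vanishes {p} _ ≤-refl))
                      ([]·-yes (p ≟ p) ≡.refl) ⟩
          (0# + 0#) + T l                  ≈⟨ trans (+-congʳ (+-identityˡ 0#)) (+-identityˡ _) ⟩
          T l                              ≈⟨ T≈stay l ⟩
          stay p l                         ∎

        inflow≈stay : ∀ k l .(k≤p : k ≤ p) .(l≤ : l ≤ q ⟨ k ⟩) →
                       inflow K p q pathFlow (node k l k≤p l≤) ≈ stay k l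
        inflow≈stay zero l k≤p l≤ = begin-equality
          _                     ≈⟨ inflow-zero l k≤p l≤ ⟩
          𝟙 (l ≟ 0)             ≈⟨ []·-⇔ (l ≟ 0) (0 ≟ l) ≡.sym ≡.sym ⟩
          𝟙 (0 ≟ l)             ≈⟨ *-identityˡ _ ⟨
          1# * 𝟙 (0 ≟ l)        ≈⟨ *-congʳ mass-μ ⟨
          mass μ * 𝟙 (0 ≟ l)    ≈⟨ ∫-const μ (𝟙 (0 ≟ l)) ⟨
          stay 0 l              ∎
        inflow≈stay (suc k) l k<p l≤ = begin-equality
          _                           ≈⟨ inflow-suc k l k<p l≤ ⟩
          V k l + shift (D k) l       ≈⟨ +-cong (V≈vert k<p′ l) (shifted l) ⟩
          vert k l + shift (diag k) l ≈⟨ join k<p′ l ⟩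
          stay (suc k) l              ∎
          where
          k<p′ : k < p
          k<p′ = recompute (k <? p) k<p
          shifted : ∀ l → shift (D k) l ≈ shift (diag k) l
          shifted zero    = refl
          shifted (suc l) = D≈diag k<p′ l

        bar-tail : ∀ i j → Σ< q (λ l → [ j ≤? l ]· X (toℕ i) l) ≈ ∫ μ (λ w → 𝟙 (j ≤? letter w i))
        bar-tail i j = begin-equality
          Σ< q (λ l → [ j ≤? l ]· X (toℕ i) l)
            ≈⟨ Σ<-cong q (λ l _ → trans ([]·-cong (j ≤? l) (X≈marginal i l)) (∫-[]· (j ≤? l) μ _)) ⟩
          Σ< q (λ l → ∫ μ (λ w → [ j ≤? l ]· 𝟙 (letter w i ≟ l)))
            ≈⟨ ∫-Σ< μ q (λ l w → [ j ≤? l ]· 𝟙 (letter w i ≟ l)) ⟩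
          ∫ μ (λ w → Σ< q (λ l → [ j ≤? l ]· 𝟙 (letter w i ≟ l)))
            ≈⟨ ∫-cong μ (λ w → trans (Σ<-cong q λ l _ → swap (j ≤? l) (letter w i ≟ l) (l ≟ letter w i)
                                                          ≡.sym ≡.sym)
                                     (Σ<-delta q (λ l → 𝟙 (j ≤? l)) (toℕ<n (Vec.lookup (proj₁ w) i)))) ⟩
          ∫ μ (λ w → 𝟙 (j ≤? letter w i)) ∎
          where
          swap : ∀ {Q R S : Set} (Q? : Dec Q) (R? : Dec R) (S? : Dec S) →
                 (R → S) → (S → R) → [ Q? ]· 𝟙 R? ≈ [ S? ]· 𝟙 Q?
          swap Q? (yes r) S? to from = sym ([]·-yes S? (to r))
          swap Q? (no ¬r) S? to from = trans ([]·-zero Q? λ _ → refl) (sym ([]·-no S? (¬r ∘ from)))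

        -- A path starts in state 0, never falls, and rises by at most one per row. So it is above
        -- `j` after `r` rows exactly if one of its steps went from `j` to `j + 1`, and at most one
        -- step can.
        diag-sum : ∀ r → r ≤ p → ∀ j → Σ< r (λ k → D k j) ≈ ∫ μ (λ w → 𝟙 (suc j ≤? σ w r))
        diag-sum zero    _   j = sym (∫-zero μ λ _ → refl)
        diag-sum (suc r) r<p j = begin-equality
          D r j + Σ< r (λ k → D k j)
            ≈⟨ +-cong (D≈diag r<p j) (diag-sum r (<⇒≤ r<p) j) ⟩
          diag r j + ∫ μ (λ w → 𝟙 (suc j ≤? σ w r))
            ≈⟨ ∫-+ μ _ _ ⟨
          ∫ μ (λ w → 𝟙 ((σ w r ≟ j) ×-dec (σ w (suc r) ≟ suc j)) + 𝟙 (suc j ≤? σ w r))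
            ≈⟨ atIndex (λ r → ∫ μ (λ w → 𝟙 ((σ w r ≟ j) ×-dec (σ w (suc r) ≟ suc j)) + 𝟙 (suc j ≤? σ w r)) ≈
                              ∫ μ (λ w → 𝟙 (suc j ≤? σ w (suc r))))
                 (λ r → ∫-cong μ λ w → 𝟙-⊎
                   ((σ w (toℕ r) ≟ j) ×-dec (σ w (suc (toℕ r)) ≟ suc j))
                   (suc j ≤? σ w (toℕ r))
                   (suc j ≤? σ w (suc (toℕ r)))
                   (λ (_ , eq) → ≤-reflexive (≡.sym eq)) (λ le → ≤-trans le (state≤state (stepAt w r)))
                   (cases (stepAt w r)) λ ((eq , _) , le) → <⇒≢ le (≡.sym eq)) r<p ⟩
          ∫ μ (λ w → 𝟙 (suc j ≤? σ w (suc r))) ∎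
          where
          cases : ∀ {a m m′} → Step a m m′ → suc j ≤ m′ → (m ≡ j × m′ ≡ suc j) ⊎ suc j ≤ m
          cases (stays ≡.refl _) le       = inj₂ le
          cases (advances ≡.refl _)    (s≤s le) with m≤n⇒m<n∨m≡n le
          ... | inj₁ lt = inj₂ lt
          ... | inj₂ eq = inj₁ (≡.sym eq , ≡.cong suc (≡.sym eq))

      pathFlow∈P⁼ : P⁼ K p q x pathFlow
      pathFlow∈P⁼ = record
        { inP = record
          { flow = record
            { nonneg       = nonneg
            ; conservation = conservation
            ; unitValue    = outflow-s
            }
          ; condA = λ { (cell i j) → ≲-trans
              (∫-mono μ λ w → 𝟙-mono ((σ w (toℕ i) ≟ toℕ j) ×-dec (σ w (suc (toℕ i)) ≟ suc (toℕ j)))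
                (letter w i ≟ toℕ j)
                (λ (eq , eq′) → onlyFresh (stepAt w i) eq eq′))
              (≲-reflexive (sym (x-marginal i j))) }
          ; condB = λ e → begin
              _ ≈⟨ bar-sum e ⟩
              _ ≈⟨ bar-tail (row₀ e) (toℕ (col₀ e)) ⟩
              -- A letter `≥ j` forces a state `> j` after its row, since the column it uses is open
              -- by then.
              _ ≤⟨ ∫-mono μ (λ w → 𝟙-mono (toℕ (col₀ e) ≤? letter w (row₀ e))
                     (suc (toℕ (col₀ e)) ≤? σ w (rowOf e))
                     (λ le → ≤-trans (s≤s le) (letter<state (stepAt w (row₀ e))))) ⟩
              _ ≈⟨ diag-sum (rowOf e) (toℕ<n (row₀ e)) (toℕ (col₀ e)) ⟨
              _ ≈⟨ in↘-col e ⟨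
              _ ∎
          }
        -- The bar from letter 0 is the whole row, and `𝟙 (0 ≤? _)` computes to `1#`.
        ; rowSums = λ i → trans (row-sum i) (trans (bar-tail i 0) mass-μ)
        }
        where
        nonneg : ∀ a → 0# ≲ pathFlow a
        nonneg (vertical i j) = ∫-nonneg μ λ w →
          𝟙-nonneg ((σ w (toℕ i) ≟ toℕ j) ×-dec (σ w (suc (toℕ i)) ≟ toℕ j))
        nonneg (diagonal i j) = ∫-nonneg μ λ w →
          𝟙-nonneg ((σ w (toℕ i) ≟ toℕ j) ×-dec (σ w (suc (toℕ i)) ≟ suc (toℕ j)))
        nonneg source         = 0≲1
        nonneg (sink j)       = ∫-nonneg μ λ w → 𝟙-nonneg (σ w p ≟ toℕ j)
        conservation : ∀ v → ¬ (v ≡ s) → ¬ (v ≡ t) → inflow K p q pathFlow v ≈ outflow K p q pathFlow v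
        conservation (node k l k≤p l≤) _   _   = trans (inflow≈stay k l k≤p l≤) (sym (outflow≈stay k l k≤p l≤))
        conservation s                 s≢s _   = ⊥-elim (s≢s ≡.refl)
        conservation t                 _   t≢t = ⊥-elim (t≢t ≡.refl)
        onlyFresh : ∀ {a m m′ l} → Step a m m′ → m ≡ l → m′ ≡ suc l → a ≡ l
        onlyFresh (stays ≡.refl _) ≡.refl ()
        onlyFresh (advances _ eq)        ≡.refl _  = eq

    O⁼⇒projP⁼ : ∀ {x : Cell p q → Carrier} → O⁼ K p q x → projP⁼ K p q x
    O⁼⇒projP⁼ {x} (X , hull , x≈X) = pathFlow μ mass-μ x marginal , pathFlow∈P⁼ μ mass-μ x marginal
      where
      open ConvexHull hull
      words : ∀ k → Σ[ v ∈ Vec (Fin q) p ] Growing 0 v × (∀ i j → point k (i , j) ≈ 𝟙 (Vec.lookup v i ≟ᶠ j))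
      words k with point∈S k
      ... | M , orbitope , point≈M with orbitope⇒growing orbitope
      ...   | v , g , M≡v = v , g , λ i j →
        trans (point≈M i j) (reflexive (≡.cong (λ b → if b then 1# else 0#) (M≡v i j)))
      μ : Measure (∃ λ (v : Vec (Fin q) p) → Growing 0 v)
      μ = tabulate λ k → (proj₁ (words k) , proj₁ (proj₂ (words k))) , weight k , nonneg k
      mass-μ : mass μ ≈ 1#
      mass-μ = trans (∫-tabulate {n = size} _ _)
        (trans (sum-cong-≋ {size} λ k → *-identityʳ (weight k)) total)
      marginal : ∀ i j → x (cell i j) ≈ ∫ μ (λ (v , _) → 𝟙 (toℕ (Vec.lookup v i) ≟ toℕ j))
      marginal i j = begin-equality
        x (cell i j)                                     ≈⟨ x≈X (cell i j) ⟩
        X (i , j′)                                       ≈⟨ combine (i , j′) ⟩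
        sum (λ k → weight k * point k (i , j′))
          ≈⟨ sum-cong-≋ {size} (λ k → *-congˡ (trans (proj₂ (proj₂ (words k)) i j′)
               ([]·-⇔ (Vec.lookup (proj₁ (words k)) i ≟ᶠ j′) (toℕ (Vec.lookup (proj₁ (words k)) i) ≟ toℕ j)
                 (λ eq → ≡.trans (≡.cong toℕ eq) (toℕ-inject≤ j _))
                 (λ eq → toℕ-injective (≡.trans eq (≡.sym (toℕ-inject≤ j _))))))) ⟩
        sum (λ k → weight k * 𝟙 (toℕ (Vec.lookup (proj₁ (words k)) i) ≟ toℕ j))
          ≈⟨ ∫-tabulate {n = size} _ _ ⟨
        ∫ μ (λ (v , _) → 𝟙 (toℕ (Vec.lookup v i) ≟ toℕ j)) ∎
        where
        j′ : Fin q
        j′ = inject≤ j (m⊓n≤n (suc (toℕ i)) q)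

corollary8 : ∀ {c ℓ₁ ℓ₂} (K : OrderedField c ℓ₁ ℓ₂) (p q : ℕ) → 1 ≤ q → q ≤ p →
    ∀ (x : Cell p q → OrderedField.Carrier K) → projP⁼ K p q x ⇔ O⁼ K p q x
corollary8 K p q 1≤q q≤p x = mk⇔
  (λ (y , x,y∈P⁼) → projP⁼⇒O⁼ (≤-trans 1≤q q≤p) x,y∈P⁼)
  (O⁼⇒projP⁼ (≤-trans 1≤q q≤p))
  where open OverField K
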